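{- Let $X$ be a finite set equipped with a probability measure $\mu$, and let $\mathcal F \subseteq L^2(\mu)$ be a collection of real-valued functions on $X$ with $\sup_{\varphi \in \mathcal F} \|\varphi\|_\infty \le 1$. Then for every $0 < \eta < e^{ -3}$ and every $f \in \Delta_X$, there exists $g \in \Delta_X$ such that: (1) $\|f-g\|_{\mathcal F} \le \eta$; (2) there is a subset $\mathcal F' \subseteq \mathcal F$ with $|\mathcal F'| \le 9\,\mathrm{Ent}_\mu(f)/\eta^2$, such that $g$ is a non-negative linear combination of degree-$d$ Riesz $\mathcal F'$-products for some \[ d \le 12\,\frac{\mathrm{Ent}_\mu(f)}{\eta} + O\!\left(\frac{\log(1/\eta)}{\log\log(1/\eta)}\right), \] where the implied constant in $O(\cdot)$ is absolute.
   Context: $L^2(\mu)$ is the space of real-valued functions on $X$ with inner product $\langle f,g\rangle = \sum_{x\in X}\mu(x)f(x)g(x)$; $\mathbb E_\mu h = \sum_x \mu(x)h(x)$ and $\|h\|_p = (\mathbb E_\mu|h|^p)^{1/p}$. The set of densities is $\Delta_X = \{f : X \to [0,\infty) : \|f\|_1 = 1\}$. The relative entropy of $f\in\Delta_X$ is $\mathrm{Ent}_\mu(f) = \mathbb E_\mu[f\log f]$ (with $0\log 0=0$). The semi-norm is $\|h\|_{\mathcal F} = \sup_{\varphi\in\mathcal F}|\langle \varphi, h\rangle|$. For a subcollection $\mathcal F'\subseteq\mathcal F$, a degree-$d$ Riesz $\mathcal F'$-product is a function $R(x) = \prod_{i=1}^d (1+\epsilon_i\varphi_i(x))$ with $d\ge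 1$, $\varphi_1,\dots,\varphi_d\in\mathcal F'$ and $\epsilon_1,\dots,\epsilon_d\in\{ -1,0,1\}$.
   Formalization: The constant function 1 (all ε_i = 0) counts as a degree-d Riesz F'-product even when F' is empty; read literally, empty F' has no Riesz products, and the claim fails e.g. for f = 1, where Ent(f) = 0 forces F' to be empty. For non-empty F' nothing changes. -}

module Defs where

open import Algebra.Bundles using (CommutativeRing; Semiring)
import Algebra.Definitions.RawSemiring as RawSemiringDefinitions
import Algebra.Construct.NaturalChoice.Max as Max
open import Axiom.ExcludedMiddle using (ExcludedMiddle)
open import Data.Fin.Base using (Fin; toℕ)
open import Data.Nat.Base as ℕ using (ℕ)
open import Data.Product.Base using (∃; _×_; _,_)
open import Data.Sum.Base using (_⊎_)
open import Data.Vec.Functional using (Vector; foldr)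
open import Level using (0ℓ) renaming (suc to lsuc)
open import Relation.Binary.Bundles using (TotalOrder)
import Relation.Binary.Construct.NonStrictToStrict as ToStrict
open import Relation.Binary.Core using (Rel)
open import Relation.Binary.Structures using (IsTotalOrder)
open import Relation.Nullary.Decidable.Core using (yes; no)
open import Relation.Unary using (Pred)

-- The real numbers are specified, uniquely up to isomorphism, as a
-- Dedekind-complete ordered field.  Equality is the setoid equality of the
-- ring.  The inverse is total, with an unspecified value at 0.
record CompleteOrderedField : Set (lsuc 0ℓ) where
  infix 4 _≤_
  infix 8 _⁻¹
  field
    commutativeRing : CommutativeRing 0ℓ 0ℓ

  open CommutativeRing commutativeRing public
    using (Carrier; _≈_; _≉_; _+_; _*_; _-_; -_; 0#; 1#; semiring)

  field
    _≤_          : Rel Carrier 0ℓ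
    isTotalOrder : IsTotalOrder _≈_ _≤_
    +-monoˡ-≤    : ∀ z {x y} → x ≤ y → x + z ≤ y + z
    *-nonNeg     : ∀ {x y} → 0# ≤ x → 0# ≤ y → 0# ≤ x * y
    0≉1          : 0# ≉ 1#
    _⁻¹          : Carrier → Carrier
    *-inverseʳ   : ∀ {x} → x ≉ 0# → x * x ⁻¹ ≈ 1#

  UpperBound : Pred Carrier 0ℓ → Pred Carrier 0ℓ
  UpperBound S u = ∀ x → S x → x ≤ u

  field
    complete : (S : Pred Carrier 0ℓ) → ∃ S → ∃ (UpperBound S) →
               ∃ λ s → UpperBound S s × (∀ u → UpperBound S u → s ≤ u)

  totalOrder : TotalOrder 0ℓ 0ℓ 0ℓ
  totalOrder = record { isTotalOrder = isTotalOrder }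

  open Max totalOrder public using (_⊔_)
  open ToStrict _≈_ _≤_ public using (_<_)
  open RawSemiringDefinitions (Semiring.rawSemiring semiring) public
    using (_^_; sum; product) renaming (_×_ to _·_)

  infixl 7 _÷_
  _÷_ : Carrier → Carrier → Carrier
  x ÷ y = x * y ⁻¹

  ∣_∣ : Carrier → Carrier
  ∣ x ∣ = x ⊔ - x

  fromℕ : ℕ → Carrier
  fromℕ n = n · 1#

  -- Supremum of a set of non-negative reals, taken in [0,∞), so that the
  -- supremum of the empty set is 0.  An unbounded set has none.
  _IsSupremumOf_ : Carrier → Pred Carrier 0ℓ → Set
  s IsSupremumOf S =
    0# ≤ s × UpperBound S s × (∀ u → 0# ≤ u → UpperBound S u → s ≤ u)

  sup⟨_⟩≤_ : Pred Carrier 0ℓ → Carrier → Set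
  sup⟨ S ⟩≤ c = ∃ λ s → (s IsSupremumOf S) × s ≤ c

  _ConvergesTo_ : (ℕ → Carrier) → Carrier → Set
  a ConvergesTo l =
    ∀ ε → 0# < ε → ∃ λ N → ∀ n → N ℕ.≤ n → ∣ a n - l ∣ < ε

-- Excluded middle turns "the limit of" and "the solution of" into total
-- functions; they take the value 0 when there is no limit or solution.
module ExpLog (em : ExcludedMiddle 0ℓ) (ℝ : CompleteOrderedField) where
  open CompleteOrderedField ℝ

  the : Pred Carrier 0ℓ → Carrier
  the P with em {∃ P}
  ... | yes (x , _) = x
  ... | no  _       = 0#

  expPartialSum : Carrier → ℕ → Carrier
  expPartialSum x n =
    sum {n} (λ k → x ^ toℕ k ÷ fromℕ (toℕ k ℕ.!))

  exp : Carrier → Carrier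
  exp x = the (expPartialSum x ConvergesTo_)

  -- For x ≤ 0 the value is 0, so that x * log x is 0 at x = 0.
  log : Carrier → Carrier
  log x = the (λ y → exp y ≈ x)

-- The finite set X is Fin n, and functions X → ℝ are vectors.
module Densities
  (em : ExcludedMiddle 0ℓ) (ℝ : CompleteOrderedField) {n : ℕ}
  where
  open CompleteOrderedField ℝ
  open ExpLog em ℝ

  Function : Set
  Function = Vector Carrier n

  _≗_ : Rel Function 0ℓ
  f ≗ g = ∀ x → f x ≈ g x

  _⊖_ : Function → Function → Function
  (f ⊖ g) x = f x - g x

  IsProbabilityMeasure : Pred Function 0ℓ
  IsProbabilityMeasure μ = (∀ x → 0# ≤ μ x) × sum μ ≈ 1#

  -- The maximum is over all of X, including points of measure zero.
  ‖_‖∞ : Function → Carrier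
  ‖ h ‖∞ = foldr _⊔_ 0# (λ x → ∣ h x ∣)

  -- sup_{φ ∈ 𝓕} ‖φ‖∞ ≤ c
  sup‖_‖∞≤_ : Pred Function 0ℓ → Carrier → Set
  sup‖ 𝓕 ‖∞≤ c = sup⟨ (λ r → ∃ λ φ → 𝓕 φ × r ≈ ‖ φ ‖∞) ⟩≤ c

  module _ (μ : Function) where

    𝔼 : Function → Carrier
    𝔼 h = sum (λ x → μ x * h x)

    ⟨_,_⟩ : Function → Function → Carrier
    ⟨ f , g ⟩ = sum (λ x → μ x * f x * g x)

    ‖_‖₁ : Function → Carrier
    ‖ h ‖₁ = 𝔼 (λ x → ∣ h x ∣)

    IsDensity : Pred Function 0ℓ
    IsDensity f = (∀ x → 0# ≤ f x) × ‖ f ‖₁ ≈ 1#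

    Ent : Function → Carrier
    Ent f = 𝔼 (λ x → f x * log (f x))

    -- ‖h‖_𝓕 ≤ c
    Seminorm≤ : Pred Function 0ℓ → Function → Carrier → Set
    Seminorm≤ 𝓕 h c = sup⟨ (λ r → ∃ λ φ → 𝓕 φ × r ≈ ∣ ⟨ φ , h ⟩ ∣) ⟩≤ c

  -- 𝓕 has at most k elements, functions being identified when pointwise equal.
  HasAtMost : ℕ → Pred (Pred Function 0ℓ) 0ℓ
  HasAtMost k 𝓕 = ∃ λ (e : Fin k → Function) → ∀ φ → 𝓕 φ → ∃ λ i → φ ≗ e i

  IsSign : Pred Carrier 0ℓ
  IsSign ε = ε ≈ - 1# ⊎ ε ≈ 0# ⊎ ε ≈ 1#

  -- Membership of φᵢ in 𝓕 is asked only when εᵢ ≠ 0, since otherwise φᵢ does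
  -- not occur in the product.  For non-empty 𝓕 this changes nothing; for
  -- empty 𝓕 it makes the constant 1 the only Riesz product of each degree.
  IsRieszProduct : Pred Function 0ℓ → ℕ → Pred Function 0ℓ
  IsRieszProduct 𝓕 d R =
    1 ℕ.≤ d ×
    ∃ λ (φ : Fin d → Function) → ∃ λ (ε : Fin d → Carrier) →
      (∀ i → IsSign (ε i)) ×
      (∀ i → ε i ≉ 0# → 𝓕 (φ i)) ×
      R ≗ (λ x → product (λ i → 1# + ε i * φ i x))

  IsNonNegCombination : Pred Function 0ℓ → Pred Function 0ℓ
  IsNonNegCombination 𝓡 g =
    ∃ λ (m : ℕ) → ∃ λ (c : Fin m → Carrier) → ∃ λ (R : Fin m → Function) →
      (∀ j → 0# ≤ c j) ×
      (∀ j → 𝓡 (R j)) ×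
      g ≗ (λ x → sum (λ j → c j * R j x))

{-# OPTIONS --safe #-}

-- Mirror descent, but with the d-th power of an affine function in place of the
-- exponential: every iterate is g = v^d with E g = 1, where
-- v = A + ∑ c (1 + εᵢ φᵢ) and A, c ≥ 0, so expanding the power writes g as a
-- non-negative combination of Riesz products of degree exactly d and nothing has
-- to be truncated.  With N = d + 1 the potential E[v^N - N f (v - 1)] starts at 1.
-- If some φ ∈ 𝓕 has |⟨φ, f - g⟩| > η, then moving v by c along ±φ and restoring
-- E v^d = 1 by a constant shift of size at most c, where c = η/2N, lowers the
-- potential by at least 2η²/9.  As long as |v - 1| ≤ 3/4, Young's inequality for
-- x log x - x and exp keeps the potential above 1 - 2 Ent f.  Hence at most
-- 9 Ent f/η² steps are made, and N ≥ 12 Ent f/η + 2 ensures |v - 1| ≤ 3/4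
-- throughout.  The error term in d is thus a constant, and log(1/η)/log log(1/η) ≥ 1.
module Submission where

open import Algebra.Bundles using (CommutativeRing)
import Algebra.Construct.NaturalChoice.Max as Max
import Algebra.Properties.CommutativeSemiring.Exp as CommutativeExp
import Algebra.Properties.Ring as RingProperties
import Algebra.Properties.Semiring.Exp as SemiringExp
import Algebra.Properties.Semiring.Mult as SemiringMult
import Algebra.Properties.Semiring.Sum as SemiringSum
import Algebra.Solver.Ring as RingSolver
open import Algebra.Solver.Ring.AlmostCommutativeRing
  using (fromCommutativeRing; _-Raw-AlmostCommutative⟶_)
open import Axiom.ExcludedMiddle using (ExcludedMiddle)
open import Data.Fin.Base as Fin using (Fin; toℕ)
open import Data.Integer.Base as ℤ using (ℤ; +_; -[1+_])
import Data.Integer.Properties as ℤ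
open import Data.Maybe.Base using (Maybe; just; nothing)
open import Data.Nat.Base as ℕ using (ℕ; zero; suc; _!)
import Data.Nat.Properties as ℕ
open import Data.Product.Base using (∃; _×_; _,_; proj₁; proj₂)
open import Data.Sum.Base using (_⊎_; inj₁; inj₂)
open import Data.Vec.Functional using (Vector; _∷_)
open import Function.Base using (case_of_; _∘_; _$_)
open import Level using (0ℓ)
open import Relation.Binary.Bundles using (TotalOrder)
open import Relation.Binary.PropositionalEquality as ≡ using (_≡_)
import Relation.Binary.Reasoning.PartialOrder as PartialOrderReasoning
import Relation.Binary.Reasoning.Setoid as SetoidReasoning
open import Relation.Nullary.Decidable.Core using (Dec; yes; no)
open import Relation.Nullary.Negation.Core using (¬_; contradiction)
open import Relation.Unary using (Pred; _⊆_)
open import Defs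

-- The potential is convex in v with gradient N (v^d - f), and both halves of a step are read off
-- its tangent inequality at the new point, so no second-order remainder has to be controlled. For
-- the constant shift the tangent term is a multiple of E[f - v^d], which is 0 once the mass is
-- restored. The shift therefore never raises the potential, and it touches only A; this is why the
-- mass is restored by adding a constant and not by rescaling v. The obstacle is the lower bound on
-- the potential: (1 + x)^N lies below exp(N x), so Young's inequality cannot be used at the rate N
-- x. It is used at N x / 2 instead, where 2 exp(N x / 2) ≤ (1 + x)^N + 1 for |x| ≤ 3/4. Halving the
-- rate costs the factor 2 in 1 - 2 Ent f, and the comparison is made for N = 4 first and then
-- raised to a power, so N is a multiple of 4. The restriction on |x| ties N to the total distance
-- travelled, and so produces the term 12 Ent f/η.

module RealAnalysis (em : ExcludedMiddle 0ℓ) (ℝ : CompleteOrderedField) where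
  open CompleteOrderedField ℝ public
  open CommutativeRing commutativeRing public
    hiding (zero; Carrier; _≈_; _≉_; _+_; _*_; _-_; -_; 0#; 1#; semiring)
  open TotalOrder totalOrder public
    using (poset; antisym; total; ≤-respˡ-≈; ≤-respʳ-≈)
    renaming (refl to ≤-refl; reflexive to ≤-reflexive; trans to ≤-trans)
  open RingProperties ring public
    using (-‿involutive; -0#≈0#; -‿distribˡ-*; -‿distribʳ-*; -‿+-comm)
  open SemiringExp semiring public using (^-congˡ; ^-assocʳ)
  open SemiringMult semiring public using (×-homo-+; ×1-homo-*)
  open SemiringSum semiring public
    using (∑-distrib-+; *-distribˡ-sum; *-distribʳ-sum; sum-cong-≋)
  open CommutativeExp commutativeSemiring public using (^-distrib-*)
  open Max totalOrder public using (x≤x⊔y; x≤y⊔x; ⊔-lub; ⊔-cong)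
  module ≤-Reasoning = PartialOrderReasoning poset

  -- Integer coefficients for the ring solver

  private
    -- con (+ 1) has to denote 1# itself, not 1# + 0#.
    fromℤ : ℤ → Carrier
    fromℤ (+ 1)    = 1#
    fromℤ (+ n)    = fromℕ n
    fromℤ -[1+ n ] = - fromℕ (suc n)

    fromℤ-+ : ∀ n → fromℤ (+ n) ≈ fromℕ n
    fromℤ-+ 0             = refl
    fromℤ-+ 1             = sym (+-identityʳ 1#)
    fromℤ-+ (suc (suc n)) = refl

    cancel : ∀ x y z → (x + y) - (x + z) ≈ y - z
    cancel x y z = begin
      (x + y) + - (x + z)       ≈⟨ +-cong (+-comm x y) (sym (-‿+-comm x z)) ⟩
      (y + x) + (- x + - z)     ≈⟨ +-assoc y x _ ⟩
      y + (x + (- x + - z))     ≈⟨ +-congˡ (sym (+-assoc x _ _)) ⟩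
      y + ((x + - x) + - z)     ≈⟨ +-congˡ (+-congʳ (-‿inverseʳ x)) ⟩
      y + (0# + - z)            ≈⟨ +-congˡ (+-identityˡ _) ⟩
      y + - z                   ∎
      where open SetoidReasoning setoid

    fromℤ-⊖ : ∀ m n → fromℤ (m ℤ.⊖ n) ≈ fromℕ m - fromℕ n
    fromℤ-⊖ m zero = trans (fromℤ-+ m) (sym (trans (+-congˡ -0#≈0#) (+-identityʳ _)))
    fromℤ-⊖ zero (suc n) = sym (+-identityˡ _)
    fromℤ-⊖ (suc m) (suc n) rewrite ℤ.[1+m]⊖[1+n]≡m⊖n m n =
      trans (fromℤ-⊖ m n) (sym (cancel 1# (fromℕ m) (fromℕ n)))

    fromℤ-+-homo : ∀ i j → fromℤ (i ℤ.+ j) ≈ fromℤ i + fromℤ j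
    fromℤ-+-homo (+ m) (+ n) =
      trans (fromℤ-+ (m ℕ.+ n))
        (trans (×-homo-+ 1# m n) (sym (+-cong (fromℤ-+ m) (fromℤ-+ n))))
    fromℤ-+-homo (+ m) -[1+ n ] = trans (fromℤ-⊖ m (suc n)) (+-congʳ (sym (fromℤ-+ m)))
    fromℤ-+-homo -[1+ m ] (+ n) =
      trans (fromℤ-⊖ n (suc m)) (trans (+-comm _ _) (+-congˡ (sym (fromℤ-+ n))))
    fromℤ-+-homo -[1+ m ] -[1+ n ] = trans
      (-‿cong (+-congˡ (trans (×-homo-+ 1# (suc m) n)
        (+-comm (fromℕ (suc m)) (fromℕ n)))))
      (trans (-‿cong (trans (sym (+-assoc 1# _ _)) (+-comm _ _))) (sym (-‿+-comm _ _)))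

    fromℤ-neg-homo : ∀ i → fromℤ (ℤ.- i) ≈ - fromℤ i
    fromℤ-neg-homo (+ zero)  = sym -0#≈0#
    fromℤ-neg-homo (+ suc n) = -‿cong (sym (fromℤ-+ (suc n)))
    fromℤ-neg-homo -[1+ n ]  = trans (fromℤ-+ (suc n)) (sym (-‿involutive _))

    fromℤ-*+ : ∀ m n → fromℤ (+ m ℤ.* + n) ≈ fromℕ m * fromℕ n
    fromℤ-*+ m n = trans (reflexive (≡.cong fromℤ (≡.sym (ℤ.pos-* m n))))
                         (trans (fromℤ-+ (m ℕ.* n)) (×1-homo-* m n))

    fromℤ-*-homo : ∀ i j → fromℤ (i ℤ.* j) ≈ fromℤ i * fromℤ j
    fromℤ-*-homo (+ m) (+ n) =
      trans (fromℤ-*+ m n) (sym (*-cong (fromℤ-+ m) (fromℤ-+ n)))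
    fromℤ-*-homo (+ m) -[1+ n ] = begin
      fromℤ (+ m ℤ.* -[1+ n ])          ≡⟨ ≡.cong fromℤ (≡.sym (ℤ.neg-distribʳ-* (+ m) (+ suc n))) ⟩
      fromℤ (ℤ.- (+ m ℤ.* + suc n))     ≈⟨ fromℤ-neg-homo (+ m ℤ.* + suc n) ⟩
      - fromℤ (+ m ℤ.* + suc n)         ≈⟨ -‿cong (fromℤ-*+ m (suc n)) ⟩
      - (fromℕ m * fromℕ (suc n))       ≈⟨ -‿distribʳ-* _ _ ⟩
      fromℕ m * - fromℕ (suc n)         ≈⟨ *-congʳ (fromℤ-+ m) ⟨
      fromℤ (+ m) * - fromℕ (suc n)     ∎
      where open SetoidReasoning setoid
    fromℤ-*-homo -[1+ m ] (+ n) = begin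
      fromℤ (-[1+ m ] ℤ.* + n)          ≡⟨ ≡.cong fromℤ (≡.sym (ℤ.neg-distribˡ-* (+ suc m) (+ n))) ⟩
      fromℤ (ℤ.- (+ suc m ℤ.* + n))     ≈⟨ fromℤ-neg-homo (+ suc m ℤ.* + n) ⟩
      - fromℤ (+ suc m ℤ.* + n)         ≈⟨ -‿cong (fromℤ-*+ (suc m) n) ⟩
      - (fromℕ (suc m) * fromℕ n)       ≈⟨ -‿distribˡ-* _ _ ⟩
      - fromℕ (suc m) * fromℕ n         ≈⟨ *-congˡ (fromℤ-+ n) ⟨
      - fromℕ (suc m) * fromℤ (+ n)     ∎
      where open SetoidReasoning setoid
    fromℤ-*-homo -[1+ m ] -[1+ n ] = begin
      fromℤ (+ suc m ℤ.* + suc n)       ≈⟨ fromℤ-*+ (suc m) (suc n) ⟩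
      fromℕ (suc m) * fromℕ (suc n)     ≈⟨ -‿involutive _ ⟨
      - - (fromℕ (suc m) * fromℕ (suc n)) ≈⟨ -‿cong (-‿distribˡ-* _ _) ⟩
      - (- fromℕ (suc m) * fromℕ (suc n)) ≈⟨ -‿distribʳ-* _ _ ⟩
      - fromℕ (suc m) * - fromℕ (suc n) ∎
      where open SetoidReasoning setoid

    fromℤ-homo : ℤ.+-*-rawRing -Raw-AlmostCommutative⟶ fromCommutativeRing commutativeRing
    fromℤ-homo = record
      { ⟦_⟧    = fromℤ
      ; +-homo = fromℤ-+-homo
      ; *-homo = fromℤ-*-homo
      ; -‿homo = fromℤ-neg-homo
      ; 0-homo = refl
      ; 1-homo = refl
      }

    fromℤ-≟ : ∀ i j → Maybe (fromℤ i ≈ fromℤ j)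
    fromℤ-≟ i j with i ℤ.≟ j
    ... | yes i≡j = just (reflexive (≡.cong fromℤ i≡j))
    ... | no _    = nothing

  open RingSolver ℤ.+-*-rawRing (fromCommutativeRing commutativeRing) fromℤ-homo
    fromℤ-≟
    public using (solve; con; _:=_; _:+_; _:*_; _:-_; :-_; _:^_)

  -- Ordered field arithmetic, absolute values and powers

  infixr 6 _⊞_
  infixr 7 _⊠_

  -- The pattern for nearly every inequality below: `y - x` is written as a certificate `r`, built
  -- by `_⊞_` and `_⊠_` from differences that are known to be non-negative, and the ring solver
  -- checks the identity.
  ≤-from : ∀ {x y r} → 0# ≤ r → y - x ≈ r → x ≤ y
  ≤-from {x} {y} {r} 0≤r eq = ≤-respˡ-≈ (+-identityˡ x) (≤-respʳ-≈
    (trans (+-congʳ (sym eq)) (solve 2 (λ x y → y :- x :+ x := y) refl x y))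
    (+-monoˡ-≤ x 0≤r))

  diff : ∀ {x y} → x ≤ y → 0# ≤ y - x
  diff {x} {y} x≤y = ≤-respˡ-≈ (-‿inverseʳ x) (+-monoˡ-≤ (- x) x≤y)

  _⊞_ : ∀ {x y} → 0# ≤ x → 0# ≤ y → 0# ≤ x + y
  _⊞_ {x} {y} 0≤x 0≤y =
    ≤-trans 0≤y (≤-respˡ-≈ (+-identityˡ y) (+-monoˡ-≤ y 0≤x))

  _⊠_ : ∀ {x y} → 0# ≤ x → 0# ≤ y → 0# ≤ x * y
  _⊠_ = *-nonNeg

  0≤x*x : ∀ x → 0# ≤ x * x
  0≤x*x x with total 0# x
  ... | inj₁ 0≤x = 0≤x ⊠ 0≤x
  ... | inj₂ x≤0 = ≤-respʳ-≈ (solve 1 (λ x → (con (+ 0) :- x) :* (con (+ 0) :- x) := x :* x) refl x)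
                     (diff x≤0 ⊠ diff x≤0)

  0≤1 : 0# ≤ 1#
  0≤1 = ≤-respʳ-≈ (*-identityˡ 1#) (0≤x*x 1#)

  0<1 : 0# < 1#
  0<1 = 0≤1 , 0≉1

  +-mono-≤ : ∀ {x y u v} → x ≤ y → u ≤ v → x + u ≤ y + v
  +-mono-≤ {x} {y} {u} {v} x≤y u≤v = ≤-from (diff x≤y ⊞ diff u≤v)
    (solve 4 (λ x y u v → (y :+ v) :- (x :+ u) := (y :- x) :+ (v :- u)) refl x y u v)

  *-monoˡ-≤ : ∀ {x y z} → 0# ≤ z → x ≤ y → z * x ≤ z * y
  *-monoˡ-≤ {x} {y} {z} 0≤z x≤y = ≤-from (0≤z ⊠ diff x≤y)
    (solve 3 (λ x y z → z :* y :- z :* x := z :* (y :- x)) refl x y z)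

  *-monoʳ-≤ : ∀ {x y z} → 0# ≤ z → x ≤ y → x * z ≤ y * z
  *-monoʳ-≤ {x} {y} {z} 0≤z x≤y = ≤-from (0≤z ⊠ diff x≤y)
    (solve 3 (λ x y z → y :* z :- x :* z := z :* (y :- x)) refl x y z)

  *-mono-≤ : ∀ {x y u v} → 0# ≤ x → 0# ≤ v → x ≤ y → u ≤ v → x * u ≤ y * v
  *-mono-≤ 0≤x 0≤v x≤y u≤v = ≤-trans (*-monoˡ-≤ 0≤x u≤v) (*-monoʳ-≤ 0≤v x≤y)

  neg-mono-≤ : ∀ {x y} → x ≤ y → - y ≤ - x
  neg-mono-≤ {x} {y} x≤y = ≤-from (diff x≤y)
    (solve 2 (λ x y → (:- x) :- (:- y) := y :- x) refl x y)

  fromℕ-nonNeg : ∀ n → 0# ≤ fromℕ n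
  fromℕ-nonNeg zero    = ≤-refl
  fromℕ-nonNeg (suc n) = 0≤1 ⊞ fromℕ-nonNeg n

  fromℕ-mono : ∀ {m n} → m ℕ.≤ n → fromℕ m ≤ fromℕ n
  fromℕ-mono {n = n} ℕ.z≤n = fromℕ-nonNeg n
  fromℕ-mono (ℕ.s≤s m≤n)   = +-mono-≤ ≤-refl (fromℕ-mono m≤n)

  <⇒≤ : ∀ {x y} → x < y → x ≤ y
  <⇒≤ = proj₁

  <⇒≱ : ∀ {x y} → x < y → ¬ (y ≤ x)
  <⇒≱ (x≤y , x≉y) y≤x = x≉y (antisym x≤y y≤x)

  ≰⇒> : ∀ {x y} → ¬ (x ≤ y) → y < x
  ≰⇒> {x} {y} x≰y with total x y
  ... | inj₁ x≤y = contradiction x≤y x≰y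
  ... | inj₂ y≤x = y≤x , λ y≈x → x≰y (≤-reflexive (sym y≈x))

  <-≤-trans : ∀ {x y z} → x < y → y ≤ z → x < z
  <-≤-trans x<y y≤z = ≤-trans (<⇒≤ x<y) y≤z ,
    λ x≈z → <⇒≱ x<y (≤-trans y≤z (≤-reflexive (sym x≈z)))

  ≤-<-trans : ∀ {x y z} → x ≤ y → y < z → x < z
  ≤-<-trans x≤y y<z = ≤-trans x≤y (<⇒≤ y<z) ,
    λ x≈z → <⇒≱ y<z (≤-trans (≤-reflexive (sym x≈z)) x≤y)

  _≤?_ : ∀ x y → Dec (x ≤ y)
  x ≤? y = em

  ≤∨> : ∀ x y → x ≤ y ⊎ y < x
  ≤∨> x y with x ≤? y
  ... | yes x≤y = inj₁ x≤y
  ... | no x≰y = inj₂ (≰⇒> x≰y)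

  <-from : ∀ {x y r} → 0# < r → y - x ≈ r → x < y
  <-from {x} {y} {r} (0≤r , 0≉r) eq = ≤-from 0≤r eq ,
    λ x≈y → 0≉r (trans (sym (-‿inverseʳ x)) (trans (+-congʳ x≈y) eq))

  diff< : ∀ {x y} → x < y → 0# < y - x
  diff< {x} {y} (x≤y , x≉y) = diff x≤y , λ 0≈y-x → x≉y
    (trans (sym (+-identityʳ x)) (trans (+-congˡ 0≈y-x)
      (solve 2 (λ x y → x :+ (y :- x) := y) refl x y)))

  <⇒≉0 : ∀ {x} → 0# < x → x ≉ 0#
  <⇒≉0 (_ , 0≉x) x≈0 = 0≉x (sym x≈0)

  x⁻¹*x≈1 : ∀ {x} → x ≉ 0# → x ⁻¹ * x ≈ 1#
  x⁻¹*x≈1 x≉0 = trans (*-comm _ _) (*-inverseʳ x≉0)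

  *-cancelˡ-≤ : ∀ {a x y} → 0# < a → a * x ≤ a * y → x ≤ y
  *-cancelˡ-≤ {a} {x} {y} 0<a ax≤ay with ≤∨> x y
  ... | inj₁ x≤y = x≤y
  ... | inj₂ y<x = contradiction
    (antisym (*-monoˡ-≤ (<⇒≤ 0<a) (<⇒≤ y<x)) ax≤ay)
    λ ay≈ax → proj₂ y<x (trans (sym (undo y)) (trans (*-congˡ ay≈ax) (undo x)))
    where
    undo : ∀ z → a ⁻¹ * (a * z) ≈ z
    undo z = trans (sym (*-assoc _ _ _)) (trans (*-congʳ (x⁻¹*x≈1 (<⇒≉0 0<a))) (*-identityˡ z))

  0<⊠ : ∀ {x y} → 0# < x → 0# < y → 0# < x * y
  0<⊠ {x} {y} 0<x 0<y = ≰⇒> λ xy≤0 →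
    <⇒≱ 0<y (*-cancelˡ-≤ 0<x (≤-respʳ-≈ (sym (zeroʳ x)) xy≤0))

  0<fromℕ : ∀ n → 0# < fromℕ (suc n)
  0<fromℕ n = <-≤-trans 0<1 (≤-from (fromℕ-nonNeg n)
    (solve 1 (λ n → (con (+ 1) :+ n) :- con (+ 1) := n) refl (fromℕ n)))

  0<⁻¹ : ∀ {x} → 0# < x → 0# < x ⁻¹
  0<⁻¹ {x} 0<x = ≰⇒> λ x⁻¹≤0 → <⇒≱ 0<1 (≤-trans
    (≤-reflexive (sym (*-inverseʳ (<⇒≉0 0<x))))
    (≤-respʳ-≈ (zeroʳ x) (*-monoˡ-≤ (<⇒≤ 0<x) x⁻¹≤0)))

  ÷-* : ∀ {x y} → 0# < y → x ÷ y * y ≈ x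
  ÷-* 0<y = trans (*-assoc _ _ _) (trans (*-congˡ (x⁻¹*x≈1 (<⇒≉0 0<y))) (*-identityʳ _))

  ≤-÷ : ∀ {x y z} → 0# < z → x * z ≤ y → x ≤ y ÷ z
  ≤-÷ {x} {y} {z} 0<z xz≤y = *-cancelˡ-≤ 0<z
    (≤-respˡ-≈ (*-comm x z) (≤-respʳ-≈ (trans (sym (÷-* 0<z)) (*-comm _ _)) xz≤y))

  ÷-≤ : ∀ {x y z} → 0# < z → y ≤ x * z → y ÷ z ≤ x
  ÷-≤ {x} {y} {z} 0<z y≤xz = *-cancelˡ-≤ 0<z
    (≤-respʳ-≈ (*-comm x z) (≤-respˡ-≈ (trans (sym (÷-* 0<z)) (*-comm _ _)) y≤xz))

  0≤÷ : ∀ {x y} → 0# ≤ x → 0# < y → 0# ≤ x ÷ y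
  0≤÷ 0≤x 0<y = 0≤x ⊠ <⇒≤ (0<⁻¹ 0<y)

  0<÷ : ∀ {x y} → 0# < x → 0# < y → 0# < x ÷ y
  0<÷ 0<x 0<y = 0<⊠ 0<x (0<⁻¹ 0<y)

  ∣x∣≤ : ∀ {x y} → x ≤ y → - x ≤ y → ∣ x ∣ ≤ y
  ∣x∣≤ = ⊔-lub

  x≤∣x∣ : ∀ x → x ≤ ∣ x ∣
  x≤∣x∣ x = x≤x⊔y x (- x)

  -x≤∣x∣ : ∀ x → - x ≤ ∣ x ∣
  -x≤∣x∣ x = x≤y⊔x x (- x)

  0≤∣x∣ : ∀ x → 0# ≤ ∣ x ∣
  0≤∣x∣ x with total 0# x
  ... | inj₁ 0≤x = ≤-trans 0≤x (x≤∣x∣ x)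
  ... | inj₂ x≤0 = ≤-trans (≤-respˡ-≈ -0#≈0# (neg-mono-≤ x≤0)) (-x≤∣x∣ x)

  ∣x∣≈x : ∀ {x} → 0# ≤ x → ∣ x ∣ ≈ x
  ∣x∣≈x {x} 0≤x = antisym (∣x∣≤ ≤-refl (≤-trans (neg-mono-≤ 0≤x) (≤-respˡ-≈ (sym -0#≈0#) 0≤x)))
                          (x≤∣x∣ x)

  ∣∣-cong : ∀ {x y} → x ≈ y → ∣ x ∣ ≈ ∣ y ∣
  ∣∣-cong x≈y = ⊔-cong x≈y (-‿cong x≈y)

  ∣x+y∣≤ : ∀ x y → ∣ x + y ∣ ≤ ∣ x ∣ + ∣ y ∣
  ∣x+y∣≤ x y = ∣x∣≤ (+-mono-≤ (x≤∣x∣ x) (x≤∣x∣ y))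
    (≤-respˡ-≈ (-‿+-comm x y) (+-mono-≤ (-x≤∣x∣ x) (-x≤∣x∣ y)))

  -- No case split on signs: 2 (ab - xy) = (a - x)(b + y) + (a + x)(b - y), and the same with y
  -- negated.
  ∣x*y∣≤ : ∀ {x y a b} → ∣ x ∣ ≤ a → ∣ y ∣ ≤ b → ∣ x * y ∣ ≤ a * b
  ∣x*y∣≤ {x} {y} {a} {b} ∣x∣≤a ∣y∣≤b = ∣x∣≤
    (*-cancelˡ-≤ (0<fromℕ 1) (≤-from (a-x ⊠ b+y ⊞ a+x ⊠ b-y)
      (solve 4 (λ x y a b → con (+ 2) :* (a :* b) :- con (+ 2) :* (x :* y)
        := (a :- x) :* (b :- :- y) :+ (a :- :- x) :* (b :- y)) refl x y a b)))
    (*-cancelˡ-≤ (0<fromℕ 1) (≤-from (a-x ⊠ b-y ⊞ a+x ⊠ b+y)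
      (solve 4 (λ x y a b → con (+ 2) :* (a :* b) :- con (+ 2) :* (:- (x :* y))
        := (a :- x) :* (b :- y) :+ (a :- :- x) :* (b :- :- y)) refl x y a b)))
    where
    a-x = diff (≤-trans (x≤∣x∣ x) ∣x∣≤a)
    a+x = diff (≤-trans (-x≤∣x∣ x) ∣x∣≤a)
    b-y = diff (≤-trans (x≤∣x∣ y) ∣y∣≤b)
    b+y = diff (≤-trans (-x≤∣x∣ y) ∣y∣≤b)

  archimedean : ∀ x → ∃ λ n → x ≤ fromℕ n
  archimedean x with em {∃ λ n → x ≤ fromℕ n}
  ... | yes p = p
  ... | no ¬p = contradiction (least (s - 1#) bound)
        (<⇒≱ (<-from 0<1 (solve 1 (λ s → s :- (s :- con (+ 1)) := con (+ 1)) refl s)))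
    where
    sup = complete (λ y → ∃ λ n → y ≈ fromℕ n) (0# , 0 , refl)
      (x , λ { y (n , y≈n) → ≤-respˡ-≈ (sym y≈n) (<⇒≤ (≰⇒> λ x≤n → ¬p (n , x≤n))) })
    s     = proj₁ sup
    upper = proj₁ (proj₂ sup)
    least = proj₂ (proj₂ sup)
    bound : ∀ y → (∃ λ n → y ≈ fromℕ n) → y ≤ s - 1#
    bound y (n , y≈n) = ≤-respˡ-≈ (sym y≈n) (≤-from (diff (upper _ (suc n , refl)))
      (solve 2 (λ s n → (s :- con (+ 1)) :- n := s :- (con (+ 1) :+ n)) refl s (fromℕ n)))

  floor : ∀ {x} → 0# ≤ x → ∃ λ n → fromℕ n ≤ x × x < fromℕ (suc n)
  floor {x} 0≤x = search (proj₁ bound) (≤-<-trans (proj₂ bound)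
      (<-from 0<1 (solve 1 (λ n → (con (+ 1) :+ n) :- n := con (+ 1)) refl _)))
    where
    bound = archimedean x
    search : ∀ n → x < fromℕ (suc n) → ∃ λ n → fromℕ n ≤ x × x < fromℕ (suc n)
    search zero    x<1+n = zero , 0≤x , x<1+n
    search (suc n) x<1+n with ≤∨> (fromℕ (suc n)) x
    ... | inj₁ n≤x = suc n , n≤x , x<1+n
    ... | inj₂ x<n = search n x<n

  ^-nonNeg : ∀ {x} n → 0# ≤ x → 0# ≤ x ^ n
  ^-nonNeg zero    0≤x = 0≤1
  ^-nonNeg (suc n) 0≤x = 0≤x ⊠ ^-nonNeg n 0≤x

  ^-mono-≤ : ∀ {x y} n → 0# ≤ x → x ≤ y → x ^ n ≤ y ^ n
  ^-mono-≤ zero    0≤x x≤y = ≤-refl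
  ^-mono-≤ (suc n) 0≤x x≤y =
    *-mono-≤ 0≤x (^-nonNeg n (≤-trans 0≤x x≤y)) x≤y (^-mono-≤ n 0≤x x≤y)

  -- Convexity of powers on the non-negative reals; the other convexity facts about powers follow
  -- from it. Multiplying the inequality for one exponent by `a` exceeds the next tangent by (n + 1)
  -- m^n (a - m)².
  ^-tangent : ∀ {a m} n → 0# ≤ a → 0# ≤ m →
              m ^ suc n + fromℕ (suc n) * m ^ n * (a - m) ≤ a ^ suc n
  ^-tangent {a} {m} zero 0≤a 0≤m = ≤-reflexive
    (solve 2 (λ a m → m :* con (+ 1) :+ (con (+ 1) :+ con (+ 0)) :* con (+ 1) :* (a :- m)
       := a :* con (+ 1)) refl a m)
  ^-tangent {a} {m} (suc n) 0≤a 0≤m = ≤-trans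
    (≤-from (fromℕ-nonNeg (suc n) ⊠ ^-nonNeg n 0≤m ⊠ 0≤x*x (a - m))
      (solve 4 (λ a m p k →
         a :* (m :* p :+ (con (+ 1) :+ k) :* p :* (a :- m))
           :- (m :* (m :* p) :+ (con (+ 1) :+ (con (+ 1) :+ k)) :* (m :* p) :* (a :- m))
         := (con (+ 1) :+ k) :* (p :* ((a :- m) :* (a :- m)))) refl a m (m ^ n) (fromℕ n)))
    (*-monoˡ-≤ 0≤a (^-tangent n 0≤a 0≤m))

  -- Tangents are taken at the mean and averaged with weights p and 1 - p, which cancels the linear
  -- terms.
  ^-convex : ∀ {a b p} n → 0# ≤ a → 0# ≤ b → 0# ≤ p → p ≤ 1# →
             (p * a + (1# - p) * b) ^ n ≤ p * a ^ n + (1# - p) * b ^ n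
  ^-convex {p = p} zero _ _ _ _ = ≤-reflexive
    (solve 1 (λ p → con (+ 1) := p :* con (+ 1) :+ (con (+ 1) :- p) :* con (+ 1)) refl p)
  ^-convex {a} {b} {p} (suc n) 0≤a 0≤b 0≤p p≤1 = ≤-from
    (0≤p ⊠ diff (^-tangent n 0≤a 0≤m) ⊞ diff p≤1 ⊠ diff (^-tangent n 0≤b 0≤m))
    (solve 7 (λ a b p A B M k →
       let m = p :* a :+ (con (+ 1) :- p) :* b in
       (p :* A :+ (con (+ 1) :- p) :* B) :- m :* M :=
       p :* (A :- (m :* M :+ k :* M :* (a :- m)))
         :+ (con (+ 1) :- p) :* (B :- (m :* M :+ k :* M :* (b :- m))))
      refl a b p (a ^ suc n) (b ^ suc n) ((p * a + (1# - p) * b) ^ n) (fromℕ (suc n)))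
    where
    0≤m : 0# ≤ p * a + (1# - p) * b
    0≤m = 0≤p ⊠ 0≤a ⊞ diff p≤1 ⊠ 0≤b

  bernoulli : ∀ {x} n → 0# ≤ 1# + x → 1# + fromℕ n * x ≤ (1# + x) ^ n
  bernoulli {x} zero _ = ≤-reflexive
      (solve 1 (λ x → con (+ 1) :+ con (+ 0) :* x := con (+ 1)) refl x)
  bernoulli {x} (suc n) 0≤1+x = ≤-trans
    (≤-from (fromℕ-nonNeg n ⊠ 0≤x*x x)
      (solve 2 (λ x n → (con (+ 1) :+ x) :* (con (+ 1) :+ n :* x) :-
          (con (+ 1) :+ (con (+ 1) :+ n) :* x)
        := n :* (x :* x)) refl x (fromℕ n)))
    (*-monoˡ-≤ 0≤1+x (bernoulli n 0≤1+x))

  1^n≈1 : ∀ n → 1# ^ n ≈ 1#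
  1^n≈1 zero    = refl
  1^n≈1 (suc n) = trans (*-identityˡ _) (1^n≈1 n)

  -- Limits and intermediate values

  convergesTo : ∀ {a : ℕ → Carrier} {l} K → 0# < K →
    (∀ ε → 0# < ε → ∃ λ N → ∀ n → N ℕ.≤ n → ∣ a n - l ∣ ≤ K * ε) → a ConvergesTo l
  convergesTo {a = a} {l = l} K 0<K close ε 0<ε = proj₁ p , λ n N≤n →
    ≤-<-trans (proj₂ p n N≤n) (<-from 0<Kε′ (trans (+-congʳ ε≈)
      (solve 2 (λ K δ → δ :* (con (+ 2) :* K) :- K :* δ := K :* δ) refl K ε′)))
    where
    0<2K = 0<⊠ (0<fromℕ 1) 0<K
    ε′ = ε ÷ (fromℕ 2 * K)
    0<ε′ = 0<÷ 0<ε 0<2K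
    0<Kε′ = 0<⊠ 0<K 0<ε′
    ε≈ : ε ≈ ε′ * (fromℕ 2 * K)
    ε≈ = sym (÷-* 0<2K)
    p = close ε′ 0<ε′

  lim-mono : ∀ {a b : ℕ → Carrier} {l m} → (∃ λ N → ∀ n → N ℕ.≤ n → a n ≤ b n) → a ConvergesTo l
      → b ConvergesTo m → l ≤ m
  lim-mono {a = a} {b = b} {l = l} {m = m} (N , a≤b) a→l b→m with ≤∨> l m
  ... | inj₁ l≤m = l≤m
  ... | inj₂ m<l = contradiction (≤-from (diff a≤bₙ ⊞ diff (<⇒≤ near-l) ⊞ diff (<⇒≤ near-m)
            ⊞ diff (-x≤∣x∣ (a n - l)) ⊞ diff (x≤∣x∣ (b n - m)))
          (solve 7 (λ ε l m a b p q → m :- (l :- (ε :+ ε)) := (b :- a) :+ ((ε :- p) :+ ((ε :- q)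
             :+ ((p :- :- (a :- l)) :+ (q :- (b :- m)))))) refl ε l m (a n) (b n) _ _))
        (<⇒≱ (<-from 0<ε (trans (solve 3
            (λ l m ε → (l :- (ε :+ ε)) :- m := (l :- m) :- ε :* con (+ 2)) refl l m ε)
           (trans (+-congʳ 3ε) (solve 1 (λ ε → ε :* con (+ 3) :- ε :* con (+ 2) := ε) refl ε)))))
    where
    ε = (l - m) ÷ fromℕ 3
    0<ε = 0<÷ (diff< m<l) (0<fromℕ 2)
    3ε : l - m ≈ ε * fromℕ 3
    3ε = sym (÷-* (0<fromℕ 2))
    N₁ = a→l ε 0<ε
    N₂ = b→m ε 0<ε
    n = N ℕ.+ (proj₁ N₁ ℕ.+ proj₁ N₂)
    a≤bₙ = a≤b n (ℕ.m≤m+n N _)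
    near-l = proj₂ N₁ n (ℕ.≤-trans (ℕ.m≤m+n _ _) (ℕ.m≤n+m _ N))
    near-m = proj₂ N₂ n (ℕ.≤-trans (ℕ.m≤n+m _ (proj₁ N₁)) (ℕ.m≤n+m _ N))

  lim-const : ∀ l → (λ _ → l) ConvergesTo l
  lim-const l ε 0<ε = 0 , λ n _ → ≤-<-trans
    (≤-reflexive (trans (∣∣-cong (-‿inverseʳ l)) (∣x∣≈x ≤-refl))) 0<ε

  lim-unique : ∀ {a b : ℕ → Carrier} {l m} → (∀ n → a n ≈ b n) → a ConvergesTo l → b ConvergesTo m
      → l ≈ m
  lim-unique a≈b a→l b→m = antisym
    (lim-mono (0 , λ n _ → ≤-reflexive (a≈b n)) a→l b→m)
    (lim-mono (0 , λ n _ → ≤-reflexive (sym (a≈b n))) b→m a→l)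

  lim-+ : ∀ {a b : ℕ → Carrier} {l m} → a ConvergesTo l → b ConvergesTo m →
      (λ n → a n + b n) ConvergesTo (l + m)
  lim-+ {a = a} {b = b} {l = l} {m = m} a→l b→m = convergesTo (fromℕ 2) (0<fromℕ 1) λ ε 0<ε →
    let N₁ , near-l = a→l ε 0<ε
        N₂ , near-m = b→m ε 0<ε
    in N₁ ℕ.+ N₂ , λ n N≤n → ≤-trans
      (≤-respˡ-≈ (∣∣-cong (solve 4 (λ a l b m → (a :- l) :+ (b :- m) := (a :+ b) :- (l :+ m))
                   refl (a n) l (b n) m))
        (∣x+y∣≤ (a n - l) (b n - m)))
      (≤-respʳ-≈ (solve 1 (λ ε → ε :+ ε := con (+ 2) :* ε) refl ε)
        (+-mono-≤ (<⇒≤ (near-l n (ℕ.m+n≤o⇒m≤o N₁ N≤n))) (<⇒≤ (near-m n (ℕ.m+n≤o⇒n≤o N₁ N≤n)))))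

  lim-* : ∀ {a b : ℕ → Carrier} {l m} → a ConvergesTo l → b ConvergesTo m →
      (λ n → a n * b n) ConvergesTo (l * m)
  lim-* {a = a} {b = b} {l = l} {m = m} a→l b→m =
    convergesTo (1# + (∣ l ∣ + ∣ m ∣)) (<-≤-trans 0<1 (≤-from (0≤∣x∣ l ⊞ 0≤∣x∣ m)
        (solve 2 (λ x y → (con (+ 1) :+ (x :+ y)) :- con (+ 1) := x :+ y) refl ∣ l ∣ ∣ m ∣))) λ ε
            0<ε →
    let N₁ , near-l = a→l ε 0<ε
        N₂ , near-m = b→m ε 0<ε
        N₃ , near-1 = a→l 1# 0<1
    in N₁ ℕ.+ (N₂ ℕ.+ N₃) , λ n N≤n →
      let N₂₃≤n = ℕ.m+n≤o⇒n≤o N₁ N≤n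
          a-l = <⇒≤ (near-l n (ℕ.m+n≤o⇒m≤o N₁ N≤n))
          b-m = <⇒≤ (near-m n (ℕ.m+n≤o⇒m≤o N₂ N₂₃≤n))
          a-1 = <⇒≤ (near-1 n (ℕ.m+n≤o⇒n≤o N₂ N₂₃≤n))
      in ≤-trans
        (≤-respˡ-≈ (∣∣-cong (solve 4
            (λ a l b m → (a :- l) :* (b :- m) :+ (l :* (b :- m) :+ m :* (a :- l))
                                := a :* b :- l :* m) refl (a n) l (b n) m))
          (≤-trans (∣x+y∣≤ _ _) (+-mono-≤ ≤-refl (∣x+y∣≤ _ _))))
        (≤-respʳ-≈ (solve 3 (λ l m ε → con (+ 1) :* ε :+ (l :* ε :+ m :* ε) :=
            (con (+ 1) :+ (l :+ m)) :* ε)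
                     refl ∣ l ∣ ∣ m ∣ ε)
          (+-mono-≤ (∣x*y∣≤ a-1 b-m) (+-mono-≤ (∣x*y∣≤ ≤-refl b-m) (∣x*y∣≤ ≤-refl a-l))))

  lim-cong : ∀ {a b : ℕ → Carrier} {l} → (∀ n → a n ≈ b n) → a ConvergesTo l → b ConvergesTo l
  lim-cong {l = l} a≈b a→l ε 0<ε = let N , near = a→l ε 0<ε in
    N , λ n N≤n → ≤-<-trans (≤-reflexive (∣∣-cong (+-congʳ (sym (a≈b n))))) (near n N≤n)

  lim-doubled : ∀ {a : ℕ → Carrier} {l} → a ConvergesTo l → (λ n → a (n ℕ.+ n)) ConvergesTo l
  lim-doubled a→l ε 0<ε = let N , near = a→l ε 0<ε in
    N , λ n N≤n → near (n ℕ.+ n) (ℕ.≤-trans N≤n (ℕ.m≤m+n n n))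

  lim-neg : ∀ {a : ℕ → Carrier} {l} → a ConvergesTo l → (λ n → - a n) ConvergesTo (- l)
  lim-neg {a = a} {l = l} a→l ε 0<ε = let N , near = a→l ε 0<ε in
    N , λ n N≤n → ≤-<-trans (∣x∣≤
      (≤-respˡ-≈ (solve 2 (λ a l → :- (a :- l) := (:- a) :- (:- l)) refl (a n) l)
          (-x≤∣x∣ (a n - l)))
      (≤-respˡ-≈ (solve 2 (λ a l → a :- l := :- ((:- a) :- (:- l))) refl (a n) l)
          (x≤∣x∣ (a n - l))))
      (near n N≤n)

  lim-squeeze : ∀ {a b : ℕ → Carrier} {l} → (∀ n → ∣ a n - l ∣ ≤ b n) → b ConvergesTo 0#
      → a ConvergesTo l
  lim-squeeze {b = b} a≤b b→0 ε 0<ε = let N , near = b→0 ε 0<ε in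
    N , λ n N≤n → ≤-<-trans (≤-trans (a≤b n)
          (≤-respˡ-≈ (solve 1 (λ b → b :- con (+ 0) := b) refl (b n)) (x≤∣x∣ (b n - 0#))))
              (near n N≤n)

  monotone-converges : ∀ {a : ℕ → Carrier} → (∀ {i j} → i ℕ.≤ j → a i ≤ a j) → ∀ u →
      (∀ n → a n ≤ u) → ∃ (a ConvergesTo_)
  monotone-converges {a = a} mono u a≤u = s , λ ε 0<ε → case em {∃ λ N → s - ε < a N} of λ where
      (yes (N , s-ε<a)) → N , λ n N≤n → near ε 0<ε N n N≤n s-ε<a
      (no ¬p) → contradiction
        (least (s - ε) λ { y (n , y≈a) → ≤-respˡ-≈ (sym y≈a) (case ≤∨> (a n) (s - ε) of λ where
           (inj₁ a≤s-ε) → a≤s-ε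
           (inj₂ s-ε<a) → contradiction (n , s-ε<a) ¬p) })
        (<⇒≱ (<-from 0<ε (solve 2 (λ s ε → s :- (s :- ε) := ε) refl s ε)))
    where
    sup = complete (λ y → ∃ λ n → y ≈ a n) (a 0 , 0 , refl)
                   (u , λ { y (n , y≈a) → ≤-respˡ-≈ (sym y≈a) (a≤u n) })
    s     = proj₁ sup
    upper = proj₁ (proj₂ sup)
    least = proj₂ (proj₂ sup)
    near : ∀ ε → 0# < ε → ∀ N n → N ℕ.≤ n → s - ε < a N → ∣ a n - s ∣ < ε
    near ε 0<ε N n N≤n s-ε<a = ≤-<-trans
      (∣x∣≤ {y = s - a N}
        (≤-trans (≤-from (diff (upper _ (n , refl)))
            (solve 2 (λ a s → con (+ 0) :- (a :- s) := s :- a) refl (a n) s))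
                 (diff (upper _ (N , refl))))
        (≤-from (diff (mono N≤n)) (solve 3 (λ a s b → (s :- b) :- :- (a :- s) := a :- b) refl
            (a n) s (a N))))
      (<-from (diff< s-ε<a) (solve 3 (λ s ε a → ε :- (s :- a) := a :- (s :- ε)) refl s ε (a N)))

  -- The solution is the supremum of the points where F ≤ t. A bound on the growth of F to the right
  -- suffices: if F c > t, all such points stay (F c - t)/Λ below c; if F c < t, either a point to
  -- the right of c or `hi` itself still has F ≤ t.
  intermediate-value :
    ∀ (F : Carrier → Carrier) {lo hi t Λ} → lo ≤ hi → 0# < Λ →
    (∀ {u v} → lo ≤ u → u ≤ v → v ≤ hi → F v ≤ F u + Λ * (v - u)) →
    F lo ≤ t → t ≤ F hi → ∃ λ c → lo ≤ c × c ≤ hi × F c ≈ t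
  intermediate-value F {lo} {hi} {t} {Λ} lo≤hi 0<Λ lipschitz Flo≤t t≤Fhi =
    c , lo≤c , c≤hi , antisym Fc≤t t≤Fc
    where
    S : Pred Carrier 0ℓ
    S x = lo ≤ x × x ≤ hi × F x ≤ t
    sup = complete S (lo , ≤-refl , lo≤hi , Flo≤t) (hi , λ x → proj₁ ∘ proj₂)
    c     = proj₁ sup
    upper = proj₁ (proj₂ sup)
    least = proj₂ (proj₂ sup)
    lo≤c = upper lo (≤-refl , lo≤hi , Flo≤t)
    c≤hi = least hi (λ x → proj₁ ∘ proj₂)
    Fc≤t : F c ≤ t
    Fc≤t with ≤∨> (F c) t
    ... | inj₁ p = p
    ... | inj₂ t<Fc = contradiction
      (least (c - e) λ x (lo≤x , x≤hi , Fx≤t) →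
        ≤-from (diff (÷-≤ {x = c - x} 0<Λ
            (≤-from (diff (lipschitz lo≤x (upper x (lo≤x , x≤hi , Fx≤t)) c≤hi) ⊞ diff Fx≤t)
            (solve 6 (λ c x t F G Λ → (c :- x) :* Λ :- (F :- t) := ((G :+ Λ :* (c :- x)) :- F) :+
                (t :- G))
              refl c x t (F c) (F x) Λ))))
          (solve 3 (λ c x e → (c :- e) :- x := (c :- x) :- e) refl c x e))
      (<⇒≱ (<-from (0<÷ (diff< t<Fc) 0<Λ) (solve 2 (λ c e → c :- (c :- e) := e) refl c e)))
      where e = (F c - t) ÷ Λ
    t≤Fc : t ≤ F c
    t≤Fc with ≤∨> t (F c)
    ... | inj₁ p = p
    ... | inj₂ Fc<t = contradiction Fc<t λ Fc<t → case ≤∨> (c + e) hi of λ where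
        (inj₁ c+e≤hi) → <⇒≱ c<c+e (upper (c + e) (≤-trans lo≤c (<⇒≤ c<c+e) , c+e≤hi ,
          ≤-trans (lipschitz lo≤c (<⇒≤ c<c+e) c+e≤hi) (≤-reflexive at-t)))
        (inj₂ hi<c+e) → <⇒≱ Fc<t (≤-trans t≤Fhi (≤-trans (lipschitz lo≤c c≤hi ≤-refl)
          (≤-from (<⇒≤ 0<Λ ⊠ diff (upper hi (lo≤hi , ≤-refl , ≤-trans (lipschitz lo≤c c≤hi ≤-refl)
              (≤-trans (+-mono-≤ ≤-refl (*-monoˡ-≤ (<⇒≤ 0<Λ) (≤-from (diff (<⇒≤ hi<c+e))
                (solve 3 (λ c e h → ((c :+ e) :- c) :- (h :- c) := (c :+ e) :- h) refl c e hi))))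
                (≤-reflexive at-t)))))
            (solve 4 (λ F Λ h c → F :- (F :+ Λ :* (h :- c)) := Λ :* (c :- h)) refl (F c) Λ hi c))))
      where
      e = (t - F c) ÷ Λ
      c<c+e = <-from (0<÷ (diff< Fc<t) 0<Λ) (solve 2 (λ c e → (c :+ e) :- c := e) refl c e)
      at-t : F c + Λ * ((c + e) - c) ≈ t
      at-t = trans (solve 4 (λ F Λ c e → F :+ Λ :* ((c :+ e) :- c) := F :+ e :* Λ) refl (F c) Λ c e)
        (trans (+-congˡ (÷-* 0<Λ)) (solve 2 (λ F t → F :+ (t :- F) := t) refl (F c) t))

  -- Partial sums and Cauchy products of series

  Sequence : Set
  Sequence = ℕ → Carrier

  partialSum : ℕ → Sequence → Carrier
  partialSum n a = sum {n} (a ∘ toℕ)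

  partialSum-cong : ∀ {a b : Sequence} n → (∀ k → a k ≈ b k) → partialSum n a ≈ partialSum n b
  partialSum-cong zero    a≈b = refl
  partialSum-cong (suc n) a≈b = +-cong (a≈b 0) (partialSum-cong n (a≈b ∘ suc))

  partialSum-suc : ∀ n (a : Sequence) → partialSum (suc n) a ≈ partialSum n a + a n
  partialSum-suc zero    a = +-comm (a 0) 0#
  partialSum-suc (suc n) a = trans (+-congˡ (partialSum-suc n (a ∘ suc))) (sym (+-assoc _ _ _))

  partialSum-nonNeg : ∀ {a : Sequence} n → (∀ k → 0# ≤ a k) → 0# ≤ partialSum n a
  partialSum-nonNeg zero    0≤a = ≤-refl
  partialSum-nonNeg (suc n) 0≤a = 0≤a 0 ⊞ partialSum-nonNeg n (0≤a ∘ suc)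

  partialSum-mono : ∀ {a : Sequence} {m n} → (∀ k → 0# ≤ a k) → m ℕ.≤ n →
                    partialSum m a ≤ partialSum n a
  partialSum-mono {n = n} 0≤a ℕ.z≤n   = partialSum-nonNeg n 0≤a
  partialSum-mono 0≤a (ℕ.s≤s m≤n) = +-mono-≤ ≤-refl (partialSum-mono (0≤a ∘ suc) m≤n)

  partialSum-dominated : ∀ {a â : Sequence} {m n} → (∀ k → ∣ a k ∣ ≤ â k) → m ℕ.≤ n →
    ∣ partialSum n a - partialSum m a ∣ ≤ partialSum n â - partialSum m â
  partialSum-dominated {n = zero} ∣a∣≤â ℕ.z≤n =
    ≤-reflexive (trans (∣x∣≈x (diff ≤-refl)) refl)
  partialSum-dominated {a} {â} {n = suc n} ∣a∣≤â ℕ.z≤n = ≤-trans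
    (≤-respˡ-≈ (∣∣-cong (solve 2 (λ x s → x :+ (s :- con (+ 0)) := (x :+ s) :- con (+ 0)) refl
        (a 0) _))
      (∣x+y∣≤ _ _))
    (≤-respʳ-≈ (solve 2 (λ x s → x :+ (s :- con (+ 0)) := (x :+ s) :- con (+ 0)) refl (â 0) _)
      (+-mono-≤ (∣a∣≤â 0) (partialSum-dominated {n = n} (∣a∣≤â ∘ suc) ℕ.z≤n)))
  partialSum-dominated {a} {â} ∣a∣≤â (ℕ.s≤s m≤n) = ≤-respˡ-≈
    (∣∣-cong (solve 3 (λ x s t → s :- t := (x :+ s) :- (x :+ t)) refl (a 0) _ _))
    (≤-respʳ-≈ (solve 3 (λ x s t → s :- t := (x :+ s) :- (x :+ t)) refl (â 0) _ _)
      (partialSum-dominated (∣a∣≤â ∘ suc) m≤n))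

  conv : Sequence → Sequence → Sequence
  conv a b zero    = a 0 * b 0
  conv a b (suc k) = a 0 * b (suc k) + conv (a ∘ suc) b k

  -- ∑_{i<n} aᵢ ∑_{j<n-i} bⱼ
  triangularSum : ℕ → Sequence → Sequence → Carrier
  triangularSum zero    a b = 0#
  triangularSum (suc n) a b = a 0 * partialSum (suc n) b + triangularSum n (a ∘ suc) b

  partialSum-conv : ∀ n a b → partialSum n (conv a b) ≈ triangularSum n a b
  partialSum-conv zero    a b = refl
  partialSum-conv (suc n) a b = begin
    a 0 * b 0 + sum {n} (λ i → a 0 * b (suc (toℕ i)) + conv (a ∘ suc) b (toℕ i))
      ≈⟨ +-congˡ (∑-distrib-+ {n} (λ i → a 0 * b (suc (toℕ i))) (conv (a ∘ suc) b ∘ toℕ)) ⟩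
    a 0 * b 0 + (sum {n} (λ i → a 0 * b (suc (toℕ i))) + partialSum n (conv (a ∘ suc) b))
      ≈⟨ +-congˡ (+-cong (sym (*-distribˡ-sum {n} (a 0) (b ∘ suc ∘ toℕ)))
          (partialSum-conv n (a ∘ suc) b)) ⟩
    a 0 * b 0 + (a 0 * partialSum n (b ∘ suc) + triangularSum n (a ∘ suc) b)
      ≈⟨ solve 4 (λ a b s t → a :* b :+ (a :* s :+ t) := a :* (b :+ s) :+ t) refl (a 0) (b 0) _ _ ⟩
    triangularSum (suc n) a b ∎
    where open SetoidReasoning setoid

  -- The triangle i + j < n lies inside the rectangle i < n, j < m, so the difference is a sum of
  -- terms aᵢ bⱼ and is dominated term by term. Keeping m apart from n lets the induction shorten
  -- one side only.
  triangularSum-remainder : ∀ {a â b b̂ : Sequence} {m} n → n ℕ.≤ m →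
    (∀ k → ∣ a k ∣ ≤ â k) → (∀ k → ∣ b k ∣ ≤ b̂ k) →
    ∣ partialSum n a * partialSum m b - triangularSum n a b ∣ ≤
      partialSum n â * partialSum m b̂ - triangularSum n â b̂
  triangularSum-remainder {b = b} {b̂} {m} zero n≤m ∣a∣≤â ∣b∣≤b̂ = ≤-reflexive
    (trans (∣∣-cong (zero* _)) (trans (∣x∣≈x ≤-refl) (sym (zero* _))))
    where
    zero* : ∀ x → 0# * x - 0# ≈ 0#
    zero* = solve 1 (λ x → con (+ 0) :* x :- con (+ 0) := con (+ 0)) refl
  triangularSum-remainder {a} {â} {b} {b̂} {m} (suc n) n≤m ∣a∣≤â ∣b∣≤b̂ = ≤-trans
    (≤-respˡ-≈ (∣∣-cong (peel (a 0) (partialSum n (a ∘ suc)) (partialSum m b)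
                          (partialSum (suc n) b) (triangularSum n (a ∘ suc) b)))
      (∣x+y∣≤ _ _))
    (≤-respʳ-≈ (peel (â 0) (partialSum n (â ∘ suc)) (partialSum m b̂)
                     (partialSum (suc n) b̂) (triangularSum n (â ∘ suc) b̂))
      (+-mono-≤ (∣x*y∣≤ (∣a∣≤â 0) (partialSum-dominated ∣b∣≤b̂ n≤m))
        (triangularSum-remainder n (ℕ.<⇒≤ n≤m) (∣a∣≤â ∘ suc) ∣b∣≤b̂)))
    where
    peel : ∀ x s u v t → x * (u - v) + (s * u - t) ≈ (x + s) * u - (x * v + t)
    peel = solve 5 (λ x s u v t → x :* (u :- v) :+ (s :* u :- t) := (x :+ s) :* u :-
        (x :* v :+ t)) refl

  -- The rectangle i < n, j < m lies inside the triangle i + j < n + m.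
  partialSum-*-≤ : ∀ {a b : Sequence} n m → (∀ k → 0# ≤ a k) → (∀ k → 0# ≤ b k) →
    partialSum n a * partialSum m b ≤ triangularSum (n ℕ.+ m) a b
  partialSum-*-≤ {a} {b} zero m 0≤a 0≤b =
    ≤-respˡ-≈ (sym (zeroˡ _)) (triangular-nonNeg m a 0≤a)
    where
    triangular-nonNeg : ∀ m a → (∀ k → 0# ≤ a k) → 0# ≤ triangularSum m a b
    triangular-nonNeg zero    a 0≤a = ≤-refl
    triangular-nonNeg (suc m) a 0≤a =
      0≤a 0 ⊠ partialSum-nonNeg (suc m) 0≤b ⊞ triangular-nonNeg m (a ∘ suc) (0≤a ∘ suc)
  partialSum-*-≤ {a} {b} (suc n) m 0≤a 0≤b = ≤-respˡ-≈ (sym (distribʳ _ _ _))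
    (+-mono-≤ (*-monoˡ-≤ (0≤a 0) (partialSum-mono 0≤b (ℕ.m≤n+m m (suc n))))
              (partialSum-*-≤ n m (0≤a ∘ suc) 0≤b))

  -- The formal derivative of the power series with these coefficients; `δ-conv` is the Leibniz
  -- rule.
  δ : Sequence → Sequence
  δ a k = fromℕ (suc k) * a (suc k)

  conv-congˡ : ∀ {a a′ b : Sequence} k → (∀ i → a i ≈ a′ i) → conv a b k ≈ conv a′ b k
  conv-congˡ zero    a≈a′ = *-congʳ (a≈a′ 0)
  conv-congˡ (suc k) a≈a′ = +-cong (*-congʳ (a≈a′ 0)) (conv-congˡ k (a≈a′ ∘ suc))

  conv-congʳ : ∀ {a b b′ : Sequence} k → (∀ i → b i ≈ b′ i) → conv a b k ≈ conv a b′ k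
  conv-congʳ zero    b≈b′ = *-congˡ (b≈b′ 0)
  conv-congʳ (suc k) b≈b′ = +-cong (*-congˡ (b≈b′ (suc k))) (conv-congʳ k b≈b′)

  conv-+ˡ : ∀ {a a′ b : Sequence} k → conv (λ i → a i + a′ i) b k ≈ conv a b k + conv a′ b k
  conv-+ˡ zero    = distribʳ _ _ _
  conv-+ˡ {a} {a′} {b} (suc k) = trans (+-congˡ (conv-+ˡ k))
    (solve 5 (λ a a′ b c d → (a :+ a′) :* b :+ (c :+ d) := (a :* b :+ c) :+ (a′ :* b :+ d))
      refl (a 0) (a′ 0) (b (suc k)) _ _)

  conv-*ˡ : ∀ {a b : Sequence} x k → conv (λ i → x * a i) b k ≈ x * conv a b k
  conv-*ˡ x zero    = *-assoc _ _ _
  conv-*ˡ x (suc k) = trans (+-cong (*-assoc _ _ _) (conv-*ˡ x k)) (sym (distribˡ _ _ _))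

  conv-*ʳ : ∀ {a b : Sequence} x k → conv a (λ i → x * b i) k ≈ x * conv a b k
  conv-*ʳ {a} {b} x zero = solve 3 (λ a x b → a :* (x :* b) := x :* (a :* b)) refl (a 0) x (b 0)
  conv-*ʳ {a} {b} x (suc k) = trans (+-congˡ (conv-*ʳ x k))
    (solve 4 (λ a x b c → a :* (x :* b) :+ x :* c := x :* (a :* b :+ c)) refl (a 0) x (b (suc k)) _)

  δ-conv : ∀ a b k → δ (conv a b) k ≈ conv (δ a) b k + conv a (δ b) k
  δ-conv a b zero = solve 4 (λ a₀ a₁ b₀ b₁ → let one = con (+ 1) :+ con (+ 0) in
      one :* (a₀ :* b₁ :+ a₁ :* b₀) := one :* a₁ :* b₀ :+ a₀ :* (one :* b₁))
      refl (a 0) (a 1) (b 0) (b 1)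
  δ-conv a b (suc k) = begin
    (1# + n) * (a 0 * b (2 ℕ.+ k) + conv (a ∘ suc) b (suc k))
      ≈⟨ solve 4 (λ n a b c → (con (+ 1) :+ n) :* (a :* b :+ c)
           := (a :* ((con (+ 1) :+ n) :* b) :+ c) :+ n :* c) refl n (a 0) _ _ ⟩
    (a 0 * δ b (suc k) + conv (a ∘ suc) b (suc k)) + δ (conv (a ∘ suc) b) k
      ≈⟨ +-congˡ (δ-conv (a ∘ suc) b k) ⟩
    (a 0 * δ b (suc k) + (a 1 * b (suc k) + conv (a ∘ suc ∘ suc) b k)) +
      (conv (δ (a ∘ suc)) b k + conv (a ∘ suc) (δ b) k)
      ≈⟨ solve 6 (λ x a₁ b₁ p q r → (x :+ (a₁ :* b₁ :+ p)) :+ (q :+ r)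
           := ((con (+ 1) :+ con (+ 0)) :* a₁ :* b₁ :+ (p :+ q)) :+ (x :+ r)) refl _ (a 1)
               (b (suc k)) _ _ _ ⟩
    (δ a 0 * b (suc k) + (conv (a ∘ suc ∘ suc) b k + conv (δ (a ∘ suc)) b k)) +
      (a 0 * δ b (suc k) + conv (a ∘ suc) (δ b) k)
      ≈⟨ +-congʳ (+-congˡ (trans (sym (conv-+ˡ k)) (conv-congˡ k λ i →
           solve 2 (λ a n → a :+ n :* a := (con (+ 1) :+ n) :* a) refl (a (2 ℕ.+ i))
               (fromℕ (suc i))))) ⟩
    conv (δ a) b (suc k) + conv a (δ b) (suc k) ∎
    where
    open SetoidReasoning setoid
    n = fromℕ (suc k)

  -- The exponential series and the logarithm

  expTerm : Carrier → Sequence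
  expTerm x k = x ^ k ÷ fromℕ (k !)

  0<k! : ∀ k → 0# < fromℕ (k !)
  0<k! k with k ! | ℕ.1≤n! k
  ... | suc m | _ = 0<fromℕ m

  δ-expTerm : ∀ x k → δ (expTerm x) k ≈ x * expTerm x k
  δ-expTerm x k = begin
    fromℕ (suc k) * (x * x ^ k * fromℕ (suc k !) ⁻¹)
      ≈⟨ *-congˡ (sym (*-identityʳ _)) ⟩
    fromℕ (suc k) * (x * x ^ k * fromℕ (suc k !) ⁻¹ * 1#)
      ≈⟨ *-congˡ (*-congˡ (sym (*-inverseʳ (<⇒≉0 (0<k! k))))) ⟩
    fromℕ (suc k) * (x * x ^ k * fromℕ (suc k !) ⁻¹ * (fromℕ (k !) * fromℕ (k !) ⁻¹))
      ≈⟨ solve 6 (λ n x p i f j → n :* (x :* p :* i :* (f :* j)) := (n :* f) :* i :*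
          (x :* (p :* j)))
           refl (fromℕ (suc k)) x (x ^ k) (fromℕ (suc k !) ⁻¹) (fromℕ (k !)) (fromℕ (k !) ⁻¹) ⟩
    fromℕ (suc k) * fromℕ (k !) * fromℕ (suc k !) ⁻¹ * (x * expTerm x k)
      ≈⟨ *-congʳ (trans (*-congʳ (sym (×1-homo-* (suc k) (k !))))
          (*-inverseʳ (<⇒≉0 (0<k! (suc k))))) ⟩
    1# * (x * expTerm x k)
      ≈⟨ *-identityˡ _ ⟩
    x * expTerm x k ∎
    where open SetoidReasoning setoid

  expTerm-0 : ∀ x → expTerm x 0 ≈ 1#
  expTerm-0 x = trans (*-congʳ (sym (+-identityʳ 1#))) (*-inverseʳ (<⇒≉0 (0<k! 0)))

  *-cancelˡ-≈ : ∀ {a x y} → 0# < a → a * x ≈ a * y → x ≈ y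
  *-cancelˡ-≈ 0<a ax≈ay = antisym (*-cancelˡ-≤ 0<a (≤-reflexive ax≈ay))
                                  (*-cancelˡ-≤ 0<a (≤-reflexive (sym ax≈ay)))

  -- In place of the binomial theorem: both sides start at 1 and satisfy the formal differential
  -- equation `δ a = (x + y) a`, which determines each coefficient from the one before.
  expTerm-+ : ∀ x y k → conv (expTerm x) (expTerm y) k ≈ expTerm (x + y) k
  expTerm-+ x y zero = trans (*-cong (expTerm-0 x) (expTerm-0 y))
    (trans (*-identityˡ 1#) (sym (expTerm-0 (x + y))))
  expTerm-+ x y (suc k) = *-cancelˡ-≈ (0<fromℕ k) (begin
    δ (conv (expTerm x) (expTerm y)) k
      ≈⟨ δ-conv (expTerm x) (expTerm y) k ⟩
    conv (δ (expTerm x)) (expTerm y) k + conv (expTerm x) (δ (expTerm y)) k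
      ≈⟨ +-cong (trans (conv-congˡ k (δ-expTerm x)) (conv-*ˡ x k))
                (trans (conv-congʳ k (δ-expTerm y)) (conv-*ʳ y k)) ⟩
    x * conv (expTerm x) (expTerm y) k + y * conv (expTerm x) (expTerm y) k
      ≈⟨ distribʳ _ x y ⟨
    (x + y) * conv (expTerm x) (expTerm y) k
      ≈⟨ *-congˡ (expTerm-+ x y k) ⟩
    (x + y) * expTerm (x + y) k
      ≈⟨ δ-expTerm (x + y) k ⟨
    δ (expTerm (x + y)) k ∎)
    where open SetoidReasoning setoid

  ∣x^n∣≤ : ∀ x n → ∣ x ^ n ∣ ≤ ∣ x ∣ ^ n
  ∣x^n∣≤ x zero    = ≤-reflexive (∣x∣≈x 0≤1)
  ∣x^n∣≤ x (suc n) = ∣x*y∣≤ ≤-refl (∣x^n∣≤ x n)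

  expTerm-dominated : ∀ x k → ∣ expTerm x k ∣ ≤ expTerm ∣ x ∣ k
  expTerm-dominated x k = ∣x*y∣≤ (∣x^n∣≤ x k) (≤-reflexive (∣x∣≈x (<⇒≤ (0<⁻¹ (0<k! k)))))

  expTerm-nonNeg : ∀ {x} → 0# ≤ x → ∀ k → 0# ≤ expTerm x k
  expTerm-nonNeg 0≤x k = 0≤÷ (^-nonNeg k 0≤x) (0<k! k)

  -- A geometric tail bound without division. From index m on, the ratio of consecutive terms is at
  -- most (q - p)/q, which says exactly that p times the partial sum plus q times the next term does
  -- not increase.
  expTerm-tail : ∀ {x p q} m → 0# ≤ x → 0# ≤ p → p ≤ q → q * x ≤ (q - p) * fromℕ (suc m) → ∀ k →
    p * partialSum (k ℕ.+ m) (expTerm x) + q * expTerm x (k ℕ.+ m) ≤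
    p * partialSum m (expTerm x) + q * expTerm x m
  expTerm-tail m 0≤x 0≤p p≤q qx≤ zero = ≤-refl
  expTerm-tail {x} {p} {q} m 0≤x 0≤p p≤q qx≤ (suc k) = ≤-trans
    (≤-from (diff shrink) (trans
        (+-congˡ (-‿cong (+-congʳ (*-congˡ (partialSum-suc (k ℕ.+ m) (expTerm x))))))
      (solve 5 (λ p q S t u → (p :* S :+ q :* t) :- (p :* (S :+ t) :+ q :* u) :=
          (q :- p) :* t :- q :* u)
        refl p q (partialSum (k ℕ.+ m) (expTerm x)) (expTerm x (k ℕ.+ m))
            (expTerm x (suc (k ℕ.+ m))))))
    (expTerm-tail m 0≤x 0≤p p≤q qx≤ k)
    where
    n = fromℕ (suc (k ℕ.+ m))
    qx≤n : q * x ≤ (q - p) * n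
    qx≤n = ≤-trans qx≤ (*-monoˡ-≤ (diff p≤q) (fromℕ-mono (ℕ.s≤s (ℕ.m≤n+m m k))))
    shrink : q * expTerm x (suc (k ℕ.+ m)) ≤ (q - p) * expTerm x (k ℕ.+ m)
    shrink = *-cancelˡ-≤ (0<fromℕ (k ℕ.+ m)) (≤-from (diff qx≤n ⊠ expTerm-nonNeg 0≤x (k ℕ.+ m))
      (trans (+-congˡ (-‿cong (trans (solve 3 (λ n q u → n :* (q :* u) := q :* (n :* u)) refl n q _)
                                (*-congˡ (δ-expTerm x (k ℕ.+ m))))))
        (solve 5 (λ n q p x t → n :* ((q :- p) :* t) :- q :* (x :* t) :=
            ((q :- p) :* n :- q :* x) :* t)
          refl n q p x (expTerm x (k ℕ.+ m)))))

  open ExpLog em ℝ public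

  the-spec : ∀ {P : Pred Carrier 0ℓ} → ∃ P → P (the P)
  the-spec {P} ∃P with em {∃ P}
  ... | yes (_ , Px) = Px
  ... | no ∄P        = contradiction ∃P ∄P

  exp-summable : ∀ x → ∃ (expPartialSum x ConvergesTo_)
  exp-summable x = _ , lim-cong
      (λ n → solve 2 (λ s t → (s :+ t) :- t := s) refl (partialSum n (expTerm x))
          (partialSum n (expTerm X)))
      (lim-+ (proj₂ sum-converges) (lim-neg (proj₂ X-converges)))
    where
    X = ∣ x ∣
    0≤X = 0≤∣x∣ x
    -- From an index m ≥ 2 |x| on, the terms at |x| at least halve, so p = 1 and q = 2 are
    -- admissible in `expTerm-tail`.
    m = proj₁ (archimedean (fromℕ 2 * X))
    B = 1# * partialSum m (expTerm X) + fromℕ 2 * expTerm X m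
    bounded : ∀ n → partialSum n (expTerm X) ≤ B
    bounded n = ≤-trans (partialSum-mono (expTerm-nonNeg 0≤X) (ℕ.m≤m+n n m))
      (≤-trans (≤-from (<⇒≤ (0<fromℕ 1) ⊠ expTerm-nonNeg 0≤X (n ℕ.+ m))
        (solve 2 (λ s t → (con (+ 1) :* s :+ t) :- s := t) refl
            (partialSum (n ℕ.+ m) (expTerm X)) _))
      (expTerm-tail m 0≤X 0≤1 (≤-from 0≤1 (solve 0 (con (+ 2) :- con (+ 1) := con (+ 1)) refl))
        (≤-trans (proj₂ (archimedean (fromℕ 2 * X))) (≤-from 0≤1
          (solve 1 (λ m → (con (+ 2) :- con (+ 1)) :* (con (+ 1) :+ m) :- m := con (+ 1)) refl
              (fromℕ m)))) n))
    X-converges = monotone-converges (partialSum-mono (expTerm-nonNeg 0≤X)) B bounded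
    -- For negative x the partial sums are not monotone. Adding the terms at |x| makes them so; the
    -- limit at |x| is subtracted afterwards.
    sum-converges : ∃ ((λ n → partialSum n (expTerm x) + partialSum n (expTerm X)) ConvergesTo_)
    sum-converges = _ , lim-cong (λ n → ∑-distrib-+ {n} (expTerm x ∘ toℕ) (expTerm X ∘ toℕ))
      (proj₂ (monotone-converges {a = λ n → partialSum n (λ k → expTerm x k + expTerm X k)}
        (partialSum-mono λ k → ≤-from (diff (≤-trans (-x≤∣x∣ _) (expTerm-dominated x k)))
          (solve 2 (λ t u → (t :+ u) :- con (+ 0) := u :- :- t) refl (expTerm x k) (expTerm X k)))
        (B + B) λ n → ≤-trans (≤-reflexive (∑-distrib-+ {n} (expTerm x ∘ toℕ) (expTerm X ∘ toℕ)))
          (+-mono-≤ (≤-trans (≤-trans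
            (≤-respˡ-≈ (solve 1 (λ s → s :- con (+ 0) := s) refl _) (x≤∣x∣ _))
            (≤-respʳ-≈ (solve 1 (λ s → s :- con (+ 0) := s) refl _)
              (partialSum-dominated {m = 0} {n} (expTerm-dominated x) ℕ.z≤n))) (bounded n))
                  (bounded n))))

  exp-sum : ∀ x → expPartialSum x ConvergesTo exp x
  exp-sum x = the-spec (exp-summable x)

  expTerm-cong : ∀ {x y} → x ≈ y → ∀ k → expTerm x k ≈ expTerm y k
  expTerm-cong x≈y k = *-congʳ (^-congˡ k x≈y)

  exp-cong : ∀ {x y} → x ≈ y → exp x ≈ exp y
  exp-cong {x} {y} x≈y =
    lim-unique (λ n → partialSum-cong n (expTerm-cong x≈y)) (exp-sum x) (exp-sum y)

  -- The product of the n-th partial sums differs from the n-th partial sum at x + y by a remainder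
  -- dominated by the same remainder at |x|, |y|. That one is at most the block of terms from n to
  -- 2n of the series at |x| + |y|, which tends to 0.
  exp-+ : ∀ x y → exp (x + y) ≈ exp x * exp y
  exp-+ x y = trans (sym (lim-unique
      {a = λ n → partialSum n (expTerm x) * partialSum n (expTerm y) +
                           - (partialSum n (expTerm x) * partialSum n (expTerm y) - partialSum n
                               (expTerm (x + y)))}
    (λ n → solve 2 (λ p q → p :+ :- (p :- q) := q) refl _ _)
    (lim-+ (lim-* (exp-sum x) (exp-sum y)) (lim-neg difference→0))
    (exp-sum (x + y)))) (solve 1 (λ p → p :+ :- con (+ 0) := p) refl _)
    where
    X = ∣ x ∣
    Y = ∣ y ∣
    T≈ : ∀ x y n → triangularSum n (expTerm x) (expTerm y) ≈ partialSum n (expTerm (x + y))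
    T≈ x y n = trans (sym (partialSum-conv n (expTerm x) (expTerm y)))
        (partialSum-cong n (expTerm-+ x y))
    difference→0 : (λ n → partialSum n (expTerm x) * partialSum n (expTerm y) - partialSum n
        (expTerm (x + y)))
                   ConvergesTo 0#
    difference→0 = lim-squeeze
        {b = λ n → partialSum (n ℕ.+ n) (expTerm (X + Y)) + - partialSum n (expTerm (X + Y))}
      (λ n → ≤-trans
        (≤-reflexive (∣∣-cong (trans (solve 1 (λ s → s :- con (+ 0) := s) refl _)
            (+-congˡ (-‿cong (sym (T≈ x y n)))))))
        (≤-trans (triangularSum-remainder n ℕ.≤-refl (expTerm-dominated x) (expTerm-dominated y))
          (+-mono-≤ (≤-respʳ-≈ (T≈ X Y (n ℕ.+ n))
              (partialSum-*-≤ n n (expTerm-nonNeg (0≤∣x∣ x)) (expTerm-nonNeg (0≤∣x∣ y))))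
            (≤-reflexive (-‿cong (T≈ X Y n))))))
      (λ ε 0<ε → let N , near = lim-+ (lim-doubled (exp-sum (X + Y))) (lim-neg (exp-sum (X + Y))) ε 0<ε in
        N , λ n N≤n → ≤-<-trans (≤-reflexive (∣∣-cong (+-congˡ (-‿cong (sym (-‿inverseʳ _))))))
            (near n N≤n))

  partialSum-2 : ∀ x → partialSum 2 (expTerm x) ≈ 1# + x
  partialSum-2 x = trans (+-cong (expTerm-0 x) (trans (+-identityʳ _)
      (trans (solve 1 (λ t → t := (con (+ 1) :+ con (+ 0)) :* t) refl _)
          (trans (δ-expTerm x 0) (*-congˡ (expTerm-0 x))))))
    (+-congˡ (*-identityʳ x))

  ∣x∣*∣x∣≈x*x : ∀ x → ∣ x ∣ * ∣ x ∣ ≈ x * x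
  ∣x∣*∣x∣≈x*x x with total 0# x
  ... | inj₁ 0≤x = *-cong (∣x∣≈x 0≤x) (∣x∣≈x 0≤x)
  ... | inj₂ x≤0 = trans (*-cong eq eq) (solve 1 (λ x → (:- x) :* (:- x) := x :* x) refl x)
    where
    eq : ∣ x ∣ ≈ - x
    eq = antisym (∣x∣≤ (≤-trans x≤0 (≤-respˡ-≈ -0#≈0# (neg-mono-≤ x≤0))) ≤-refl) (-x≤∣x∣ x)

  -- The exponential series from the quadratic term on is dominated by a
  -- geometric series with first term x²/2 and ratio 1/3.
  exp-≤-quadratic : ∀ {x} → ∣ x ∣ ≤ 1# → fromℕ 4 * exp x ≤ fromℕ 4 * (1# + x) + fromℕ 3 * (x * x)
  exp-≤-quadratic {x} X≤1 = lim-mono (2 , bound)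
    (lim-* (lim-const (fromℕ 4)) (exp-sum x)) (lim-const (fromℕ 4 * (1# + x) + fromℕ 3 * (x * x)))
    where
    X = ∣ x ∣
    0≤X = 0≤∣x∣ x
    quadratic : fromℕ 2 * expTerm X 2 ≈ x * x
    quadratic = trans (δ-expTerm X 1) (trans (*-congˡ (trans
      (trans (solve 1 (λ t → t := (con (+ 1) :+ con (+ 0)) :* t) refl _) (δ-expTerm X 0))
      (trans (*-congˡ (expTerm-0 X)) (*-identityʳ X)))) (∣x∣*∣x∣≈x*x x))
    tail : ∀ k → fromℕ 2 * partialSum (k ℕ.+ 2) (expTerm X) ≤
                 fromℕ 2 * partialSum 2 (expTerm X) + fromℕ 3 * expTerm X 2
    tail k = ≤-trans (≤-from (<⇒≤ (0<fromℕ 2) ⊠ expTerm-nonNeg 0≤X (k ℕ.+ 2))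
        (solve 2 (λ s t → (s :+ t) :- s := t) refl _ _))
      (expTerm-tail 2 0≤X (fromℕ-nonNeg 2) (fromℕ-mono (ℕ.n≤1+n 2))
        (≤-from (<⇒≤ (0<fromℕ 2) ⊠ diff X≤1)
          (solve 1 (λ x → (con (+ 3) :- con (+ 2)) :* con (+ 3) :- con (+ 3) :* x := con (+ 3) :*
              (con (+ 1) :- x)) refl X)) k)
    bound : ∀ n → 2 ℕ.≤ n → fromℕ 4 * partialSum n (expTerm x) ≤ fromℕ 4 * (1# + x) + fromℕ 3 *
        (x * x)
    bound n 2≤n with k ← n ℕ.∸ 2 | ≡.refl ← ≡.sym (ℕ.m∸n+n≡m 2≤n) = ≤-respʳ-≈
      (+-cong (*-congˡ (partialSum-2 x)) (*-congˡ quadratic))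
      (≤-from (<⇒≤ (0<fromℕ 1) ⊠ diff (tail k) ⊞
               <⇒≤ (0<fromℕ 3) ⊠ diff (≤-trans (x≤∣x∣ _)
                   (partialSum-dominated (expTerm-dominated x) 2≤n)))
        (solve 5 (λ s t S T u → (con (+ 4) :* s :+ con (+ 3) :* (con (+ 2) :* u)) :- con
            (+ 4) :* t :=
            con (+ 2) :* ((con (+ 2) :* S :+ con (+ 3) :* u) :- con (+ 2) :* T) :+
            con (+ 4) :* ((T :- S) :- (t :- s)))
          refl (partialSum 2 (expTerm x)) (partialSum n (expTerm x))
               (partialSum 2 (expTerm X)) (partialSum n (expTerm X)) (expTerm X 2)))

  exp-≥-linear-nonNeg : ∀ {x} → 0# ≤ x → 1# + x ≤ exp x
  exp-≥-linear-nonNeg {x} 0≤x = lim-mono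
    (2 , λ n 2≤n → ≤-respˡ-≈ (partialSum-2 x) (partialSum-mono (expTerm-nonNeg 0≤x) 2≤n))
    (lim-const (1# + x)) (exp-sum x)

  exp-0 : exp 0# ≈ 1#
  exp-0 = antisym
    (*-cancelˡ-≤ (0<fromℕ 3) (≤-trans (exp-≤-quadratic (≤-trans (≤-reflexive (∣x∣≈x ≤-refl)) 0≤1))
      (≤-reflexive (solve 0 (con (+ 4) :* (con (+ 1) :+ con (+ 0)) :+ con (+ 3) :*
          (con (+ 0) :* con (+ 0))
         := con (+ 4) :* con (+ 1)) refl))))
    (≤-respˡ-≈ (+-identityʳ 1#) (exp-≥-linear-nonNeg ≤-refl))

  exp-inverse : ∀ x → exp x * exp (- x) ≈ 1#
  exp-inverse x = trans (sym (exp-+ x (- x))) (trans (exp-cong (-‿inverseʳ x)) exp-0)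

  0≤exp : ∀ x → 0# ≤ exp x
  0≤exp x = ≤-respʳ-≈ (trans (sym (exp-+ h h)) (exp-cong
      (trans (solve 1 (λ h → h :+ h := h :* con (+ 2)) refl h) (÷-* (0<fromℕ 1)))))
    (0≤x*x (exp h))
    where h = x ÷ fromℕ 2

  0<exp : ∀ x → 0# < exp x
  0<exp x = 0≤exp x , λ 0≈exp → 0≉1
    (trans (trans (sym (zeroˡ _)) (*-congʳ 0≈exp)) (exp-inverse x))

  -- For -1 < x ≤ 0 the reciprocal is used: `exp-≤-quadratic` at -x yields exp(-x) (1 + x) ≤ 1.
  exp-≥-linear : ∀ x → 1# + x ≤ exp x
  exp-≥-linear x with total 0# x
  ... | inj₁ 0≤x = exp-≥-linear-nonNeg 0≤x
  ... | inj₂ x≤0 with ≤∨> (1# + x) 0#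
  ...   | inj₁ 1+x≤0 = ≤-trans 1+x≤0 (0≤exp x)
  ...   | inj₂ 0<1+x = *-cancelˡ-≤ (0<exp (- x)) (≤-respʳ-≈
          (trans (sym (exp-inverse x)) (*-comm _ _))
          (*-cancelˡ-≤ (0<fromℕ 3) (≤-from
            (<⇒≤ 0<1+x ⊠ diff (exp-≤-quadratic ∣-x∣≤1) ⊞ 0≤x*x x ⊠ (0≤1 ⊞ fromℕ-nonNeg 3 ⊠ 0≤-x))
            (solve 2 (λ x e → con (+ 4) :* con (+ 1) :- con (+ 4) :* (e :* (con (+ 1) :+ x)) :=
               (con (+ 1) :+ x) :* ((con (+ 4) :* (con (+ 1) :+ :- x) :+ con (+ 3) :*
                   (:- x :* :- x)) :- con (+ 4) :* e) :+
               x :* x :* (con (+ 1) :+ con (+ 3) :* :- x)) refl x (exp (- x))))))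
    where
    0≤-x : 0# ≤ - x
    0≤-x = ≤-respˡ-≈ -0#≈0# (neg-mono-≤ x≤0)
    ∣-x∣≤1 : ∣ - x ∣ ≤ 1#
    ∣-x∣≤1 = ≤-trans (≤-reflexive (∣x∣≈x 0≤-x))
      (≤-from (<⇒≤ 0<1+x) (solve 1 (λ x → con (+ 1) :- :- x := con (+ 1) :+ x) refl x))

  exp-tangent : ∀ u t → exp u * (1# + (t - u)) ≤ exp t
  exp-tangent u t = ≤-respʳ-≈
    (trans (sym (exp-+ u (t - u))) (exp-cong (solve 2 (λ u t → u :+ (t :- u) := t) refl u t)))
    (*-monoˡ-≤ (0≤exp u) (exp-≥-linear (t - u)))

  exp-mono-≤ : ∀ {u t} → u ≤ t → exp u ≤ exp t
  exp-mono-≤ {u} {t} u≤t = ≤-trans (≤-from (0≤exp u ⊠ diff u≤t)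
    (solve 3 (λ e u t → e :* (con (+ 1) :+ (t :- u)) :- e := e :* (t :- u)) refl (exp u) u t))
        (exp-tangent u t)

  exp-log : ∀ {y} → 0# < y → exp (log y) ≈ y
  exp-log {y} 0<y = the-spec {λ t → exp t ≈ y} (c , exp-c≈y)
    where
    -- exp(1/y) ≥ 1/y, hence exp(-1/y) ≤ y. At the other end exp y ≥ y.
    lo = - (y ⁻¹)
    lo≤0 : lo ≤ 0#
    lo≤0 = ≤-respʳ-≈ -0#≈0# (neg-mono-≤ (<⇒≤ (0<⁻¹ 0<y)))
    exp-lo≤y : exp lo ≤ y
    exp-lo≤y = *-cancelˡ-≤ (0<exp (y ⁻¹)) (≤-trans (≤-reflexive (exp-inverse (y ⁻¹)))
      (≤-respˡ-≈ (x⁻¹*x≈1 (<⇒≉0 0<y)) (*-monoʳ-≤ (<⇒≤ 0<y)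
        (≤-trans (≤-from 0≤1 (solve 1 (λ i → (con (+ 1) :+ i) :- i := con (+ 1)) refl (y ⁻¹)))
          (exp-≥-linear (y ⁻¹))))))
    y≤exp-y : y ≤ exp y
    y≤exp-y = ≤-trans (≤-from 0≤1 (solve 1 (λ y → (con (+ 1) :+ y) :- y := con (+ 1)) refl y))
        (exp-≥-linear y)
    solution = intermediate-value exp (≤-trans lo≤0 (<⇒≤ 0<y)) (0<exp y)
      (λ {u} {v} _ u≤v v≤y → ≤-from (diff (exp-tangent v u) ⊞ diff (exp-mono-≤ v≤y) ⊠ diff u≤v)
        (solve 5 (λ U V Y u v → (U :+ Y :* (v :- u)) :- V :=
          (U :- V :* (con (+ 1) :+ (u :- v))) :+ (Y :- V) :* (v :- u)) refl (exp u) (exp v)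
              (exp y) u v))
      exp-lo≤y y≤exp-y
    c = proj₁ solution
    exp-c≈y = proj₂ (proj₂ (proj₂ solution))

  -- Legendre duality: the tangent to exp at log x, evaluated at t. At x = 0 the factor x removes
  -- log x, and positivity of exp remains.
  entropy-young : ∀ {x} t → 0# ≤ x → x * t ≤ x * log x - x + exp t
  entropy-young {x} t 0≤x with ≤∨> x 0#
  ... | inj₁ x≤0 = ≤-from (0≤exp t) (trans (solve 4 (λ x t l e → (x :* l :- x :+ e) :- x :* t :=
          e :+ x :* (l :- con (+ 1) :- t)) refl x t (log x) (exp t))
          (trans (+-congˡ (trans (*-congʳ (antisym x≤0 0≤x)) (zeroˡ _))) (+-identityʳ _)))
  ... | inj₂ 0<x = ≤-from (diff (exp-tangent (log x) t)) (trans
          (solve 4 (λ x t l e → (x :* l :- x :+ e) :- x :* t := e :- x :* (con (+ 1) :+ (t :- l)))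
            refl x t (log x) (exp t))
          (+-congˡ (-‿cong (*-congʳ (sym (exp-log 0<x))))))

  -- Powers compared with exponentials, and powers under perturbation

  ^-midpoint : ∀ {a b m} n → 0# ≤ a → 0# ≤ b → 0# ≤ m → fromℕ 2 * m ≤ a + b →
               fromℕ 2 * m ^ n ≤ a ^ n + b ^ n
  ^-midpoint zero _ _ _ _ = ≤-reflexive
      (solve 0 (con (+ 2) :* con (+ 1) := con (+ 1) :+ con (+ 1)) refl)
  ^-midpoint {a} {b} {m} (suc n) 0≤a 0≤b 0≤m 2m≤a+b = ≤-from
    (diff (^-tangent n 0≤a 0≤m) ⊞ diff (^-tangent n 0≤b 0≤m) ⊞
        (fromℕ-nonNeg (suc n) ⊠ ^-nonNeg n 0≤m) ⊠ diff 2m≤a+b)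
    (solve 7 (λ a b m A B P k → (A :+ B) :- con (+ 2) :* (m :* P) :=
       (A :- (m :* P :+ k :* P :* (a :- m))) :+ ((B :- (m :* P :+ k :* P :* (b :- m)))
         :+ k :* P :* ((a :+ b) :- con (+ 2) :* m)))
      refl a b m (a ^ suc n) (b ^ suc n) (m ^ n) (fromℕ (suc n)))

  exp-fromℕ-* : ∀ n x → exp (fromℕ n * x) ≈ exp x ^ n
  exp-fromℕ-* zero    x = trans (exp-cong (zeroˡ x)) exp-0
  exp-fromℕ-* (suc n) x = trans
      (exp-cong (solve 2 (λ n x → (con (+ 1) :+ n) :* x := x :+ n :* x) refl (fromℕ n) x))
    (trans (exp-+ x (fromℕ n * x)) (*-congˡ (exp-fromℕ-* n x)))

  module _ {x} (3-4x≥0 : 0# ≤ fromℕ 3 - fromℕ 4 * x) (3+4x≥0 : 0# ≤ fromℕ 3 + fromℕ 4 * x) where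

    ∣x∣≤1 : ∣ x ∣ ≤ 1#
    ∣x∣≤1 = ∣x∣≤
      (*-cancelˡ-≤ (0<fromℕ 3) (≤-from (3-4x≥0 ⊞ 0≤1)
        (solve 1 (λ x → con (+ 4) :* con (+ 1) :- con (+ 4) :* x := (con (+ 3) :- con (+ 4) :* x)
            :+ con (+ 1)) refl x)))
      (*-cancelˡ-≤ (0<fromℕ 3) (≤-from (3+4x≥0 ⊞ 0≤1)
        (solve 1 (λ x → con (+ 4) :* con (+ 1) :- con (+ 4) :* :- x :=
            (con (+ 3) :+ con (+ 4) :* x) :+ con (+ 1)) refl x)))

    -- Both sides agree to first order at x = 0. With Q = 4 + 4x + 3x² ≥ 4 exp x, the gap 128 ((1 +
    -- x)⁴ + 1) - 16 Q² equals x² (128 + 128x - 16x²), and the bounds on x make the last factor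
    -- positive. The summand 1 is needed for negative x, where (1 + x)⁴ < exp(2x).
    exp-2x-≤ : fromℕ 2 * exp x ^ 2 ≤ (1# + x) ^ 4 + 1#
    exp-2x-≤ = *-cancelˡ-≤ (0<fromℕ 127) (≤-from
      (0≤x*x x ⊠ (3-4x≥0 ⊠ 3+4x≥0 ⊞ fromℕ-nonNeg 32 ⊠ 3+4x≥0 ⊞ fromℕ-nonNeg 23)
        ⊞ fromℕ-nonNeg 16 ⊠ (bound ⊠ (bound ⊞ fromℕ-nonNeg 8 ⊠ 0≤exp x)))
      (solve 2 (λ x e →
         let Q = con (+ 4) :* (con (+ 1) :+ x) :+ con (+ 3) :* (x :* x)
             p = con (+ 3) :- con (+ 4) :* x
             q = con (+ 3) :+ con (+ 4) :* x
         in con (+ 128) :* ((con (+ 1) :+ x) :^ 4 :+ con (+ 1)) :- con (+ 128) :*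
             (con (+ 2) :* e :^ 2) :=
            x :* x :* (p :* q :+ (con (+ 32) :* q :+ con (+ 23)))
              :+ con (+ 16) :* ((Q :- con (+ 4) :* e) :* ((Q :- con (+ 4) :* e) :+ con (+ 8) :* e)))
        refl x (exp x)))
      where bound = diff (exp-≤-quadratic ∣x∣≤1)

    -- `exp-2x-≤` says that exp(2x) is at most the midpoint of (1 + x)⁴ and 1; convexity of the M-th
    -- power does the rest.
    exp-≤-power : ∀ M → fromℕ 2 * exp (fromℕ M * (fromℕ 2 * x)) ≤ (1# + x) ^ (4 ℕ.* M) + 1#
    exp-≤-power M = ≤-respˡ-≈ (*-congˡ
        (trans (^-congˡ M (sym (exp-fromℕ-* 2 x))) (sym (exp-fromℕ-* M _))))
      (≤-respʳ-≈ (+-cong (^-assocʳ (1# + x) 4 M) (1^n≈1 M))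
        (^-midpoint M (^-nonNeg 4 0≤1+x) 0≤1 (^-nonNeg 2 (0≤exp x)) exp-2x-≤))
      where
      0≤1+x : 0# ≤ 1# + x
      0≤1+x = ≤-respˡ-≈ (-‿inverseʳ 1#) (+-mono-≤ ≤-refl (≤-from (diff (≤-trans (-x≤∣x∣ x) ∣x∣≤1))
         (solve 1 (λ x → x :- :- con (+ 1) := con (+ 1) :- :- x) refl x)))

    -- Young's inequality at exp (2 M x), which (1 + (1+x)^{4M}) / 2 dominates.
    power-young : ∀ {f} M → 0# ≤ f →
      1# + fromℕ (4 ℕ.* M) * (f * x) ≤ (1# + x) ^ (4 ℕ.* M) + fromℕ 2 * (f * log f - f + 1#)
    power-young {f} M 0≤f = ≤-from
      (fromℕ-nonNeg 2 ⊠ diff (entropy-young (fromℕ M * (fromℕ 2 * x)) 0≤f) ⊞ diff (exp-≤-power M))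
      (trans (+-congˡ (-‿cong (+-congˡ (*-congʳ (×1-homo-* 4 M)))))
       (solve 6 (λ f x l e M P → (P :+ con (+ 2) :* (f :* l :- f :+ con (+ 1))) :-
           (con (+ 1) :+ con (+ 4) :* M :* (f :* x))
        := con (+ 2) :* ((f :* l :- f :+ e) :- f :* (M :* (con (+ 2) :* x))) :+
            ((P :+ con (+ 1)) :- con (+ 2) :* e))
        refl f x (log f) (exp (fromℕ M * (fromℕ 2 * x))) (fromℕ M) ((1# + x) ^ (4 ℕ.* M))))

  -- Whatever the sign of w, the change of the power along w is controlled by the forward difference
  -- with step c. For w ≤ 0 the backward difference appears first, and by convexity it is at most
  -- the forward one; c ≤ v keeps its base v - c non-negative.
  ^-perturb : ∀ {v c w} d → 0# ≤ c → c ≤ v → w ≤ 1# → - w ≤ 1# →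
    ((v + c * w) ^ d - v ^ d) * w ≤ (v + c) ^ d - v ^ d
  ^-perturb {v} {c} {w} d 0≤c c≤v w≤1 -w≤1 with total 0# w
  ... | inj₁ 0≤w = ≤-trans
      (≤-from (diff (^-mono-≤ d 0≤v v≤v+cw) ⊠ diff w≤1)
        (solve 2 (λ D w → D :- D :* w := D :* (con (+ 1) :- w)) refl _ w))
      (+-mono-≤ (^-mono-≤ d (≤-trans 0≤v v≤v+cw) (+-mono-≤ ≤-refl
        (≤-respʳ-≈ (*-identityʳ c) (*-monoˡ-≤ 0≤c w≤1)))) ≤-refl)
    where
    0≤v = ≤-trans 0≤c c≤v
    v≤v+cw : v ≤ v + c * w
    v≤v+cw = ≤-from (0≤c ⊠ 0≤w) (solve 2 (λ v z → (v :+ z) :- v := z) refl v _)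
  ... | inj₂ w≤0 = ≤-from
      (diff (^-mono-≤ d 0≤v+cw v+cw≤v) ⊠ diff -w≤1
        ⊞ diff (^-mono-≤ d (diff c≤v) v-c≤v+cw)
        ⊞ diff (^-midpoint d (0≤v ⊞ 0≤c) (diff c≤v) 0≤v
            (≤-reflexive (solve 2 (λ v c → con (+ 2) :* v := (v :+ c) :+ (v :- c)) refl v c))))
      (solve 5 (λ w V P Q R → (Q :- V) :- (P :- V) :* w :=
          (V :- P) :* (con (+ 1) :- :- w) :+ ((P :- R) :+ ((Q :+ R) :- con (+ 2) :* V)))
        refl w (v ^ d) ((v + c * w) ^ d) ((v + c) ^ d) ((v - c) ^ d))
    where
    0≤v = ≤-trans 0≤c c≤v
    v+cw≤v : v + c * w ≤ v
    v+cw≤v = ≤-from (0≤c ⊠ diff w≤0)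
        (solve 3 (λ v c w → v :- (v :+ c :* w) := c :* (con (+ 0) :- w)) refl v c w)
    v-c≤v+cw : v - c ≤ v + c * w
    v-c≤v+cw = ≤-from (0≤c ⊠ diff -w≤1)
        (solve 3 (λ v c w → (v :+ c :* w) :- (v :- c) := c :* (con (+ 1) :- :- w)) refl v c w)
    0≤v+cw = ≤-trans (diff c≤v) v-c≤v+cw

  -- Convexity of the power at v + c = (1+c) (p v + (1-p) 1), where p = 1/(1+c).
  ^-shift : ∀ {v c} d → 0# ≤ v → 0# ≤ c →
    (v + c) ^ d ≤ (1# + c) ^ d * ((1# + c) ⁻¹ * v ^ d + (1# - (1# + c) ⁻¹))
  ^-shift {v} {c} d 0≤v 0≤c = ≤-respˡ-≈ (trans (sym (^-distrib-* (1# + c) _ d)) (^-congˡ d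
      (trans (solve 3 (λ v c p → (con (+ 1) :+ c) :* (p :* v :+ (con (+ 1) :- p) :* con (+ 1)) :=
                ((con (+ 1) :+ c) :* p) :* (v :- con (+ 1)) :+ (con (+ 1) :+ c)) refl v c p)
        (trans (+-congʳ (*-congʳ (*-inverseʳ (<⇒≉0 0<1+c))))
          (solve 2 (λ v c → con (+ 1) :* (v :- con (+ 1)) :+ (con (+ 1) :+ c) := v :+ c) refl v
              c)))))
    (*-monoˡ-≤ (^-nonNeg d (<⇒≤ 0<1+c)) (≤-respʳ-≈
      (+-congˡ (trans (*-congˡ (1^n≈1 d)) (*-identityʳ _)))
      (^-convex d 0≤v 0≤1 (<⇒≤ (0<⁻¹ 0<1+c)) p≤1)))
    where
    p = (1# + c) ⁻¹
    0<1+c : 0# < 1# + c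
    0<1+c = <-≤-trans 0<1 (≤-from 0≤c (solve 1 (λ c → (con (+ 1) :+ c) :- con (+ 1) := c) refl c))
    p≤1 : p ≤ 1#
    p≤1 = *-cancelˡ-≤ 0<1+c (≤-respˡ-≈ (sym (*-inverseʳ (<⇒≉0 0<1+c)))
      (≤-from 0≤c (solve 1 (λ c → (con (+ 1) :+ c) :* con (+ 1) :- con (+ 1) := c) refl c)))

  -- Bernoulli gives 1 - d c ≤ (1 - c)^d, and (1 + c)(1 - c) ≤ 1.
  bernoulli-reciprocal : ∀ {c} d → 0# ≤ c → c ≤ 1# → (1# + c) ^ d * (1# - fromℕ d * c) ≤ 1#
  bernoulli-reciprocal {c} d 0≤c c≤1 = ≤-trans
    (*-monoˡ-≤ (^-nonNeg d (0≤1 ⊞ 0≤c)) (≤-respˡ-≈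
      (solve 2 (λ n c → con (+ 1) :+ n :* :- c := con (+ 1) :- n :* c) refl (fromℕ d) c)
      (bernoulli d (diff c≤1))))
    (≤-respˡ-≈ (^-distrib-* (1# + c) (1# - c) d) (≤-respʳ-≈ (1^n≈1 d)
      (^-mono-≤ d ((0≤1 ⊞ 0≤c) ⊠ diff c≤1) (≤-from (0≤x*x c)
        (solve 1 (λ c → con (+ 1) :- (con (+ 1) :+ c) :* (con (+ 1) :- c) := c :* c) refl c)))))

  ^-lipschitz : ∀ {a b B} d → 0# ≤ a → a ≤ b → b ≤ B → b ^ suc d ≤ a ^ suc d + fromℕ
      (suc d) * B ^ d * (b - a)
  ^-lipschitz {a} {b} {B} d 0≤a a≤b b≤B = ≤-from
    (diff (^-tangent d 0≤a 0≤b) ⊞ (fromℕ-nonNeg (suc d) ⊠ diff (^-mono-≤ d 0≤b b≤B)) ⊠ diff a≤b)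
    (solve 7 (λ a b n P Q A B → (A :+ n :* Q :* (b :- a)) :- B :=
       (A :- (B :+ n :* P :* (a :- b))) :+ n :* (Q :- P) :* (b :- a))
      refl a b (fromℕ (suc d)) (b ^ d) (B ^ d) (a ^ suc d) (b ^ suc d))
    where 0≤b = ≤-trans 0≤a a≤b

  -- Suprema, and numerical bounds for small η

  bounded-sup : ∀ {S : Pred Carrier 0ℓ} {b} → (∀ r → S r → 0# ≤ r) → 0# ≤ b → UpperBound S b
      → sup⟨ S ⟩≤ b
  bounded-sup {S} {b} 0≤S 0≤b bound = s ,
    (upper 0# (inj₂ refl) , (λ r r∈S → upper r (inj₁ r∈S)) ,
      λ u 0≤u u-bound → least u λ { r (inj₁ r∈S) → u-bound r r∈S ; r (inj₂ r≈0) → ≤-respˡ-≈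
          (sym r≈0) 0≤u }) ,
    least b λ { r (inj₁ r∈S) → bound r r∈S ; r (inj₂ r≈0) → ≤-respˡ-≈ (sym r≈0) 0≤b }
    where
    -- Adjoining 0 makes the set non-empty and turns its least upper bound into the supremum within
    -- [0,∞).
    sup = complete (λ r → S r ⊎ r ≈ 0#) (0# , inj₂ refl)
      (b , λ { r (inj₁ r∈S) → bound r r∈S ; r (inj₂ r≈0) → ≤-respˡ-≈ (sym r≈0) 0≤b })
    s = proj₁ sup
    upper = proj₁ (proj₂ sup)
    least = proj₂ (proj₂ sup)

  ∣h∣≤‖h‖∞ : ∀ {n} (h : Vector Carrier n) x → ∣ h x ∣ ≤ Densities.‖_‖∞ em ℝ h
  ∣h∣≤‖h‖∞ h Fin.zero    = x≤x⊔y _ _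
  ∣h∣≤‖h‖∞ h (Fin.suc x) = ≤-trans (∣h∣≤‖h‖∞ (h ∘ Fin.suc) x) (x≤y⊔x _ _)

  ∣φ∣≤ : ∀ {n b} (𝓕 : Pred (Vector Carrier n) 0ℓ) → Densities.sup‖_‖∞≤_ em ℝ 𝓕 b →
         ∀ {φ} → 𝓕 φ → ∀ x → ∣ φ x ∣ ≤ b
  ∣φ∣≤ 𝓕 (s , (_ , ‖𝓕‖≤s , _) , s≤b) {φ} φ∈𝓕 x =
    ≤-trans (∣h∣≤‖h‖∞ φ x) (≤-trans (‖𝓕‖≤s _ (φ , φ∈𝓕 , refl)) s≤b)

  module _ {η} (0<η : 0# < η) (η<e⁻³ : η < exp (- fromℕ 3)) where

    -- Splitting e³ = e · e² before applying 1 + x ≤ exp x gives e³ ≥ 2 · 3; at x = 3 directly it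
    -- would give only 4.
    5η≤1 : fromℕ 5 * η ≤ 1#
    5η≤1 = ≤-trans (*-mono-≤ (fromℕ-nonNeg 5) (0≤exp _)
        (≤-trans (≤-from 0≤1 (solve 0
            ((con (+ 1) :+ con (+ 1)) :* (con (+ 1) :+ con (+ 2)) :- con (+ 5) := con (+ 1)) refl))
          (≤-trans (*-mono-≤ (0≤1 ⊞ 0≤1) (0≤exp _) (exp-≥-linear 1#) (exp-≥-linear (fromℕ 2)))
            (≤-reflexive (sym (exp-+ 1# (fromℕ 2))))))
        (<⇒≤ η<e⁻³))
      (≤-reflexive (exp-inverse (fromℕ 3)))

    -- 4e ≤ 11 by `exp-≤-quadratic` at 1, whereas 1/η ≥ 5. Strictness makes log log(1/η) positive.
    1<log[1/η] : 1# < log (1# ÷ η)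
    1<log[1/η] = ≰⇒> λ L≤1 → <⇒≱ (0<fromℕ 8) (≤-from
        (fromℕ-nonNeg 5 ⊠ diff (4≤11η L≤1) ⊞ fromℕ-nonNeg 11 ⊠ diff 5η≤1)
        (solve 1 (λ η → con (+ 0) :- con (+ 9) :=
          con (+ 5) :* (con (+ 11) :* η :- con (+ 4)) :+ con (+ 11) :*
              (con (+ 1) :- con (+ 5) :* η)) refl η))
      where
      4≤11η : log (1# ÷ η) ≤ 1# → fromℕ 4 ≤ fromℕ 11 * η
      4≤11η L≤1 = begin
        fromℕ 4                          ≈⟨ *-identityʳ _ ⟨
        fromℕ 4 * 1#                     ≈⟨ *-congˡ (÷-* 0<η) ⟨
        fromℕ 4 * (1# ÷ η * η)           ≈⟨ *-assoc _ _ _ ⟨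
        fromℕ 4 * (1# ÷ η) * η           ≈⟨ *-congʳ (*-congˡ (exp-log (0<÷ 0<1 0<η))) ⟨
        fromℕ 4 * exp (log (1# ÷ η)) * η ≤⟨ *-monoʳ-≤ (<⇒≤ 0<η)
            (*-monoˡ-≤ (fromℕ-nonNeg 4) (exp-mono-≤ L≤1)) ⟩
        fromℕ 4 * exp 1# * η             ≤⟨ *-monoʳ-≤ (<⇒≤ 0<η)
            (exp-≤-quadratic (≤-reflexive (∣x∣≈x 0≤1))) ⟩
        (fromℕ 4 * (1# + 1#) + fromℕ 3 * (1# * 1#)) * η
          ≈⟨ *-congʳ (solve 0 (con (+ 4) :* (con (+ 1) :+ con (+ 1)) :+ con (+ 3) :*
              (con (+ 1) :* con (+ 1)) := con (+ 11)) refl) ⟩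
        fromℕ 11 * η                     ∎
        where open ≤-Reasoning

    1≤log/loglog : 1# ≤ log (1# ÷ η) ÷ log (log (1# ÷ η))
    1≤log/loglog = ≤-÷ 0<logL (≤-respˡ-≈ (sym (*-identityˡ _)) (≤-trans
        (≤-from 0≤1 (solve 1 (λ l → (con (+ 1) :+ l) :- l := con (+ 1)) refl _))
        (≤-respʳ-≈ exp-logL≈L (exp-≥-linear (log L)))))
      where
      L = log (1# ÷ η)
      exp-logL≈L : exp (log L) ≈ L
      exp-logL≈L = exp-log (≤-<-trans 0≤1 1<log[1/η])
      0<logL : 0# < log L
      0<logL = ≰⇒> λ logL≤0 → <⇒≱ 1<log[1/η]
        (≤-respˡ-≈ exp-logL≈L (≤-respʳ-≈ exp-0 (exp-mono-≤ logL≤0)))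

-- Non-negative combinations of Riesz products

module OnFiniteSet (em : ExcludedMiddle 0ℓ) (ℝ : CompleteOrderedField) {n : ℕ} where
  open RealAnalysis em ℝ
  open Densities em ℝ {n} hiding (𝔼)

  -- A record, so that 𝓡 and g can be inferred.
  record Combination (𝓡 : Pred Function 0ℓ) (g : Function) : Set where
    constructor combination
    field get : IsNonNegCombination 𝓡 g

  combination-zero : ∀ {𝓡} → Combination 𝓡 (λ _ → 0#)
  combination-zero = combination (0 , (λ ()) , (λ ()) , (λ ()) , (λ ()) , λ _ → refl)

  combination-cons : ∀ {𝓡 R g a} → 0# ≤ a → 𝓡 R → Combination 𝓡 g →
                     Combination 𝓡 (λ x → a * R x + g x)
  combination-cons {R = R} {a = a} 0≤a R∈𝓡 (combination (m , c , Rs , 0≤c , Rs∈𝓡 , g≗))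
      = combination $
    suc m , a ∷ c , R ∷ Rs ,
    (λ { Fin.zero → 0≤a ; (Fin.suc j) → 0≤c j }) ,
    (λ { Fin.zero → R∈𝓡 ; (Fin.suc j) → Rs∈𝓡 j }) ,
    λ x → +-congˡ (g≗ x)

  combination-cong : ∀ {𝓡 g h} → g ≗ h → Combination 𝓡 g → Combination 𝓡 h
  combination-cong g≗h (combination (m , c , R , 0≤c , R∈𝓡 , g≗)) = combination $
    m , c , R , 0≤c , R∈𝓡 , λ x → trans (sym (g≗h x)) (g≗ x)

  combination-+ : ∀ {𝓡 g h} → Combination 𝓡 g → Combination 𝓡 h →
                  Combination 𝓡 (λ x → g x + h x)
  combination-+ {𝓡} {h = h} (combination (m , c , R , 0≤c , R∈𝓡 , g≗)) h∈ =
    combination-cong (λ x → +-congʳ (sym (g≗ x))) (go m c R 0≤c R∈𝓡)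
    where
    go : ∀ m (c : Fin m → Carrier) (R : Fin m → Function) → (∀ j → 0# ≤ c j) → (∀ j → 𝓡 (R j)) →
         Combination 𝓡 (λ x → sum (λ j → c j * R j x) + h x)
    go zero    c R 0≤c R∈𝓡 = combination-cong (λ x → sym (+-identityˡ _)) h∈
    go (suc m) c R 0≤c R∈𝓡 = combination-cong (λ x → sym (+-assoc _ _ _))
      (combination-cons (0≤c Fin.zero) (R∈𝓡 Fin.zero)
        (go m (c ∘ Fin.suc) (R ∘ Fin.suc) (0≤c ∘ Fin.suc) (R∈𝓡 ∘ Fin.suc)))

  combination-* : ∀ {𝓡 𝓢} {g u : Function} {a} → 0# ≤ a → (∀ {R} → 𝓡 R → 𝓢 (λ x → u x * R x)) →
    Combination 𝓡 g → Combination 𝓢 (λ x → a * u x * g x)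
  combination-* {u = u} {a} 0≤a mul (combination (m , c , R , 0≤c , R∈𝓡 , g≗)) = combination $
    m , (λ j → a * c j) , (λ j x → u x * R j x) , (λ j → 0≤a ⊠ 0≤c j) , (λ j → mul (R∈𝓡 j)) ,
    λ x → trans (*-congˡ (g≗ x)) (trans (*-distribˡ-sum {m} (a * u x) (λ j → c j * R j x))
      (sum-cong-≋ {m} λ j → solve 4 (λ a u c R → a :* u :* (c :* R) := a :* c :* (u :* R)) refl a
          (u x) (c j) (R j x)))

  combination-map : ∀ {𝓡 𝓢 g} → (∀ {R} → 𝓡 R → 𝓢 R) → Combination 𝓡 g → Combination 𝓢 g
  combination-map 𝓡⊆𝓢 (combination (m , c , R , 0≤c , R∈𝓡 , g≗))
      = combination $ m , c , R , 0≤c , 𝓡⊆𝓢 ∘ R∈𝓡 , g≗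

  module _ (𝓕′ : Pred Function 0ℓ) where

    -- IsRieszProduct with the degree 0 allowed.
    record IsProduct (d : ℕ) (R : Function) : Set where
      constructor isProduct
      field
        φ       : Fin d → Function
        ε       : Fin d → Carrier
        sign    : ∀ i → IsSign (ε i)
        φ∈      : ∀ i → ε i ≉ 0# → 𝓕′ (φ i)
        R≗      : R ≗ (λ x → product (λ i → 1# + ε i * φ i x))

    product-cons : ∀ {d φ ε R} → IsSign ε → (ε ≉ 0# → 𝓕′ φ) → IsProduct d R →
                   IsProduct (suc d) (λ x → (1# + ε * φ x) * R x)
    product-cons {φ = φ₀} {ε₀} sign₀ φ₀∈ (isProduct φ ε sign φ∈ R≗) = isProduct
      (φ₀ ∷ φ) (ε₀ ∷ ε)
      (λ { Fin.zero → sign₀ ; (Fin.suc i) → sign i })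
      (λ { Fin.zero → φ₀∈ ; (Fin.suc i) → φ∈ i })
      (λ x → *-congˡ (R≗ x))

    module _ {t} (φ : Fin t → Function) (ε : Fin t → Carrier)
             (sign : ∀ i → IsSign (ε i)) (φ∈ : ∀ i → 𝓕′ (φ i)) {A c} (0≤A : 0# ≤ A)
                 (0≤c : 0# ≤ c) where

      affine : Function
      affine x = A + sum {t} (λ i → c * (1# + ε i * φ i x))

      affine-* : ∀ {g d} → Combination (IsProduct d) g →
                 Combination (IsProduct (suc d)) (λ x → affine x * g x)
      affine-* {g = g} {d} g∈ = combination-cong (λ x → sym (distribʳ _ _ _))
        (combination-+ constant (combination-cong (λ x → sym (*-distribʳ-sum {t} (g x) _))
            (go t φ ε sign φ∈)))
        where
        constant : Combination (IsProduct (suc d)) (λ x → A * g x)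
        constant = combination-cong
          (λ x → solve 2 (λ A g → A :* (con (+ 1) :+ con (+ 0) :* con (+ 0)) :* g := A :* g) refl
              A (g x))
          -- The constant A becomes A times a factor with sign 0. This pads every product to the
          -- same degree, and with sign 0 nothing has to lie in 𝓕′.
          (combination-* {u = λ _ → 1# + 0# * 0#} 0≤A
            (product-cons {φ = λ _ → 0#} (inj₂ (inj₁ refl)) (λ 0≉0 → contradiction refl 0≉0)) g∈)
        go : ∀ t (φ : Fin t → Function) (ε : Fin t → Carrier) → (∀ i → IsSign (ε i)) →
            (∀ i → 𝓕′ (φ i)) →
          Combination (IsProduct (suc d)) (λ x → sum {t} (λ i → c * (1# + ε i * φ i x) * g x))
        go zero    φ ε sign φ∈ = combination-zero
        go (suc t) φ ε sign φ∈ = combination-+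
          (combination-* {u = λ x → 1# + ε Fin.zero * φ Fin.zero x} 0≤c
            (product-cons {φ = φ Fin.zero} (sign Fin.zero) (λ _ → φ∈ Fin.zero)) g∈)
          (go t (φ ∘ Fin.suc) (ε ∘ Fin.suc) (sign ∘ Fin.suc) (φ∈ ∘ Fin.suc))

      affine-^ : ∀ d → Combination (IsProduct d) (λ x → affine x ^ d)
      affine-^ zero = combination-cong
          (λ x → solve 0 (con (+ 1) :* con (+ 1) :+ con (+ 0) := con (+ 1)) refl)
        (combination-cons {R = λ _ → 1#} 0≤1
            (isProduct (λ ()) (λ ()) (λ ()) (λ ()) λ _ → refl) combination-zero)
      affine-^ (suc d) = affine-* (affine-^ d)

      affine-riesz : ∀ d → Combination (IsRieszProduct 𝓕′ (suc d)) (λ x → affine x ^ suc d)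
      affine-riesz d = combination-map
        (λ { (isProduct φ ε sign φ∈ R≗) → ℕ.s≤s ℕ.z≤n , φ , ε , sign , φ∈ , R≗ })
        (affine-^ (suc d))

  -- Expectation with respect to μ

  module Measure (μ : Function) (μ-prob : IsProbabilityMeasure μ) where

    private
      0≤μ = proj₁ μ-prob
      ∑μ≈1 = proj₂ μ-prob

    𝔼 : Function → Carrier
    𝔼 = Densities.𝔼 em ℝ μ

    sum-mono : ∀ {m} {g h : Vector Carrier m} → (∀ i → g i ≤ h i) → sum g ≤ sum h
    sum-mono {zero}  g≤h = ≤-refl
    sum-mono {suc m} g≤h = +-mono-≤ (g≤h Fin.zero) (sum-mono (g≤h ∘ Fin.suc))

    𝔼-mono : ∀ {g h} → (∀ x → g x ≤ h x) → 𝔼 g ≤ 𝔼 h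
    𝔼-mono g≤h = sum-mono λ x → *-monoˡ-≤ (0≤μ x) (g≤h x)

    𝔼-cong : ∀ {g h} → g ≗ h → 𝔼 g ≈ 𝔼 h
    𝔼-cong g≗h = sum-cong-≋ {n} λ x → *-congˡ (g≗h x)

    𝔼-+ : ∀ g h → 𝔼 (λ x → g x + h x) ≈ 𝔼 g + 𝔼 h
    𝔼-+ g h = trans (sum-cong-≋ {n} λ x → distribˡ _ _ _) (∑-distrib-+ {n} _ _)

    𝔼-* : ∀ a h → 𝔼 (λ x → a * h x) ≈ a * 𝔼 h
    𝔼-* a h = trans (sum-cong-≋ {n} λ x → solve 3 (λ m a h → m :* (a :* h) := a :* (m :* h)) refl
        (μ x) a (h x))
      (sym (*-distribˡ-sum {n} a _))

    𝔼-const : ∀ a → 𝔼 (λ _ → a) ≈ a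
    𝔼-const a = trans (sym (*-distribʳ-sum {n} a μ)) (trans (*-congʳ ∑μ≈1) (*-identityˡ a))

    𝔼-neg : ∀ h → 𝔼 (λ x → - h x) ≈ - 𝔼 h
    𝔼-neg h = trans (𝔼-cong λ x → solve 1 (λ h → :- h := (:- con (+ 1)) :* h) refl (h x))
      (trans (𝔼-* (- 1#) h) (solve 1 (λ h → (:- con (+ 1)) :* h := :- h) refl _))

    𝔼-- : ∀ g h → 𝔼 (λ x → g x - h x) ≈ 𝔼 g - 𝔼 h
    𝔼-- g h = trans (𝔼-+ g (λ x → - h x)) (+-congˡ (𝔼-neg h))

    -- Minkowski's inequality in L^d for v, which has norm 1, and the constant c, raised to the
    -- power d.
    𝔼-shift-≤ : ∀ {v : Function} {c} d → (∀ x → 0# ≤ v x) → 0# ≤ c → 𝔼 (λ x → v x ^ d) ≈ 1# →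
                𝔼 (λ x → (v x + c) ^ d) ≤ (1# + c) ^ d
    𝔼-shift-≤ {v} {c} d 0≤v 0≤c mass = ≤-trans (𝔼-mono λ x → ^-shift d (0≤v x) 0≤c) (≤-reflexive
      (trans (𝔼-* _ _) (trans (*-congˡ
          (trans (𝔼-+ _ _) (+-cong (trans (𝔼-* _ _) (*-congˡ mass)) (𝔼-const _))))
        (solve 2 (λ k p → k :* (p :* con (+ 1) :+ (con (+ 1) :- p)) := k) refl _ _))))

  -- The potential and a single descent step

  module Density (μ : Function) (μ-prob : IsProbabilityMeasure μ)
                 (f : Function) (f-density : IsDensity μ f) where
    open Measure μ μ-prob public

    0≤f : ∀ x → 0# ≤ f x
    0≤f = proj₁ f-density

    𝔼f≈1 : 𝔼 f ≈ 1#
    𝔼f≈1 = trans (𝔼-cong λ x → sym (∣x∣≈x (0≤f x))) (proj₂ f-density)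

    -- A convex function of v whose gradient at v is N (v^(N-1) - f).
    potential : ℕ → Function → Carrier
    potential N v = 𝔼 (λ x → v x ^ N - fromℕ N * (f x * (v x - 1#)))

    potential-1 : ∀ N → potential N (λ _ → 1#) ≈ 1#
    potential-1 N = trans (𝔼-cong λ x → trans (+-congʳ (1^n≈1 N))
        (solve 2 (λ n f → con (+ 1) :- n :* (f :* (con (+ 1) :- con (+ 1))) := con (+ 1)) refl
            (fromℕ N) (f x)))
      (𝔼-const 1#)

    -- The tangent is taken at v′, which will be the new point. This leaves no remainder; the price
    -- is that v′^d stands next to f where the violation speaks of v^d.
    potential-tangent : ∀ {v v′ : Function} d → (∀ x → 0# ≤ v x) → (∀ x → 0# ≤ v′ x) →
      potential (suc d) v′ + fromℕ (suc d) * 𝔼 (λ x → (f x - v′ x ^ d) * (v′ x - v x)) ≤ potential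
          (suc d) v
    potential-tangent {v} {v′} d 0≤v 0≤v′ = ≤-trans
      (≤-reflexive (sym (trans (𝔼-+ _ _) (+-congˡ (𝔼-* _ _)))))
      (𝔼-mono λ x → ≤-from (diff (^-tangent d (0≤v x) (0≤v′ x)))
        (solve 6 (λ v v′ V P f k →
            (V :- k :* (f :* (v :- con (+ 1)))) :-
            ((v′ :* P :- k :* (f :* (v′ :- con (+ 1)))) :+ k :* ((f :- P) :* (v′ :- v)))
            := V :- (v′ :* P :+ k :* P :* (v :- v′)))
          refl (v x) (v′ x) (v x ^ suc d) (v′ x ^ d) (f x) (fromℕ (suc d))))

    1≤potential+2Ent : ∀ {v : Function} M →
      (∀ x → 0# ≤ fromℕ 3 - fromℕ 4 * (v x - 1#)) → (∀ x → 0# ≤ fromℕ 3 + fromℕ 4 * (v x - 1#)) →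
      1# ≤ potential (4 ℕ.* M) v + fromℕ 2 * Ent μ f
    1≤potential+2Ent {v} M upper lower = ≤-respˡ-≈ (𝔼-const 1#) (≤-trans
      (𝔼-mono λ x → ≤-from (diff (power-young (upper x) (lower x) M (0≤f x)))
        (trans (+-congʳ (+-congʳ (+-congʳ (^-congˡ (4 ℕ.* M)
            (solve 1 (λ v → v := con (+ 1) :+ (v :- con (+ 1))) refl (v x))))))
          (solve 5 (λ V n f v l →
            ((V :- n :* (f :* (v :- con (+ 1)))) :+ con (+ 2) :* ((f :* l) :+ (con (+ 1) :- f)))
                :- con (+ 1) :=
            (V :+ con (+ 2) :* (f :* l :- f :+ con (+ 1))) :-
                (con (+ 1) :+ n :* (f :* (v :- con (+ 1)))))
            refl ((1# + (v x - 1#)) ^ (4 ℕ.* M)) (fromℕ (4 ℕ.* M)) (f x) (v x) (log (f x)))))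
      (≤-reflexive (trans (𝔼-+ _ _) (+-congˡ (trans (𝔼-* _ _) (*-congˡ
        (trans (𝔼-+ _ _) (trans (+-congˡ
            (trans (𝔼-- (λ _ → 1#) f) (trans (+-cong (𝔼-const 1#) (-‿cong 𝔼f≈1)) (-‿inverseʳ 1#))))
          (+-identityʳ _)))))))))

    -- At v = 1 the potential is 1, so the lower bound there reads 1 ≤ 1 + 2 Ent f.
    0≤Ent : 0# ≤ Ent μ f
    0≤Ent = *-cancelˡ-≤ (0<fromℕ 1) (≤-from (diff (1≤potential+2Ent {λ _ → 1#} 0
        (λ x → ≤-from (fromℕ-nonNeg 3)
            (solve 0 ((con (+ 3) :- con (+ 4) :* (con (+ 1) :- con (+ 1))) :- con (+ 0) := con
              (+ 3)) refl))
        (λ x → ≤-from (fromℕ-nonNeg 3)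
            (solve 0 ((con (+ 3) :+ con (+ 4) :* (con (+ 1) :- con (+ 1))) :- con (+ 0) := con
              (+ 3)) refl))))
      (trans (solve 1 (λ e → con (+ 2) :* e :- con (+ 2) :* con (+ 0) :=
          (con (+ 1) :+ con (+ 2) :* e) :- con (+ 1)) refl (Ent μ f))
        (+-congʳ (+-congʳ (sym (potential-1 0))))))

    -- First v moves to `v₁` along w, then a constant y restores the mass. Each move is at most c
    -- pointwise, so the margins of 2c keep the function between 0 and 2.
    potential-descent : ∀ {c η} {v w : Function} e → let d = suc e; N = suc d in
      0# ≤ c → (∀ x → c + c ≤ v x) → (∀ x → v x + (c + c) ≤ fromℕ 2) →
      (∀ x → w x ≤ 1#) → (∀ x → - w x ≤ 1#) →
      𝔼 (λ x → v x ^ d) ≈ 1# → η ≤ 𝔼 (λ x → (f x - v x ^ d) * w x) →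
      ∃ λ y → - c ≤ y × y ≤ c × 𝔼 (λ x → (v x + c * w x + y) ^ d) ≈ 1# ×
        potential N (λ x → v x + c * w x + y) + fromℕ N * (c * (η - ((1# + c) ^ d - 1#)))
            ≤ potential N v
    potential-descent {c} {η} {v} {w} e 0≤c 2c≤v v+2c≤2 w≤1 -w≤1 mass violation =
      y , -c≤y , y≤c , mass′ , ≤-trans (+-mono-≤ step₂ ≤-refl) step₁
      where
      d = suc e
      N = suc d
      v₁ : Function
      v₁ x = v x + c * w x
      c≤v : ∀ x → c ≤ v x
      c≤v x = ≤-trans (≤-from 0≤c (solve 1 (λ c → (c :+ c) :- c := c) refl c)) (2c≤v x)
      0≤v : ∀ x → 0# ≤ v x
      0≤v x = ≤-trans 0≤c (c≤v x)
      c≤v₁ : ∀ x → c ≤ v₁ x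
      c≤v₁ x = ≤-from (diff (2c≤v x) ⊞ 0≤c ⊠ diff (-w≤1 x))
        (solve 3 (λ v c w → (v :+ c :* w) :- c := (v :- (c :+ c)) :+ c :* (con (+ 1) :- :- w))
            refl (v x) c (w x))
      v₁≤v+c : ∀ x → v₁ x ≤ v x + c
      v₁≤v+c x = ≤-from (0≤c ⊠ diff (w≤1 x))
        (solve 3 (λ v c w → (v :+ c) :- (v :+ c :* w) := c :* (con (+ 1) :- w)) refl (v x) c (w x))
      0≤v₁+ : ∀ {y} x → - c ≤ y → 0# ≤ v₁ x + y
      0≤v₁+ x -c≤y = ≤-respˡ-≈ (-‿inverseʳ c) (+-mono-≤ (c≤v₁ x) -c≤y)
      v₁-c≤v : ∀ x → v₁ x + - c ≤ v x
      v₁-c≤v x = ≤-from (diff (v₁≤v+c x))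
          (solve 3 (λ v u c → v :- (u :+ :- c) := (v :+ c) :- u) refl (v x) (v₁ x) c)
      v≤v₁+c : ∀ x → v x ≤ v₁ x + c
      v≤v₁+c x = ≤-from (0≤c ⊠ diff (-w≤1 x))
        (solve 3 (λ v c w → ((v :+ c :* w) :+ c) :- v := c :* (con (+ 1) :- :- w)) refl (v x) c
            (w x))
      v₁+≤2 : ∀ {y} x → y ≤ c → v₁ x + y ≤ fromℕ 2
      v₁+≤2 x y≤c = ≤-trans (+-mono-≤ (v₁≤v+c x) y≤c)
        (≤-trans (≤-reflexive (+-assoc _ _ _)) (v+2c≤2 x))
      -- d 2^(d-1) bounds the derivative of the d-th power on [0,2].
      Λ = fromℕ d * fromℕ 2 ^ e
      0<Λ : 0# < Λ
      0<Λ = 0<⊠ (0<fromℕ e) (0<2^ e)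
        where
        0<2^ : ∀ k → 0# < fromℕ 2 ^ k
        0<2^ zero    = 0<1
        0<2^ (suc k) = 0<⊠ (0<fromℕ 1) (0<2^ k)
      -- `v₁ - c ≤ v ≤ v₁ + c` pointwise, so the mass is at most 1 at y = -c and at least 1 at y =
      -- c.
      normaliser = intermediate-value (λ y → 𝔼 (λ x → (v₁ x + y) ^ d))
        (≤-from (0≤c ⊞ 0≤c) (solve 1 (λ c → c :- :- c := c :+ c) refl c)) 0<Λ
        (λ {a} {b} -c≤a a≤b b≤c → ≤-trans
          (𝔼-mono λ x → ≤-trans (^-lipschitz e (0≤v₁+ x -c≤a) (+-mono-≤ ≤-refl a≤b) (v₁+≤2 x b≤c))
            (≤-reflexive (+-congˡ (*-congˡ
                (solve 3 (λ v a b → (v :+ b) :- (v :+ a) := b :- a) refl (v₁ x) a b)))))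
          (≤-reflexive (trans (𝔼-+ _ _) (+-congˡ (𝔼-const _)))))
        (≤-respʳ-≈ mass (𝔼-mono λ x → ^-mono-≤ d (0≤v₁+ x ≤-refl) (v₁-c≤v x)))
        (≤-respˡ-≈ mass (𝔼-mono λ x → ^-mono-≤ d (0≤v x) (v≤v₁+c x)))
      y = proj₁ normaliser
      -c≤y = proj₁ (proj₂ normaliser)
      y≤c = proj₁ (proj₂ (proj₂ normaliser))
      mass′ = proj₂ (proj₂ (proj₂ normaliser))
      -- Replacing v₁^d by v^d next to w loses at most E[(v + c)^d - v^d] by `^-perturb`, and this
      -- is at most (1 + c)^d - 1 by `𝔼-shift-≤`.
      gain : c * (η - ((1# + c) ^ d - 1#)) ≤ 𝔼 (λ x → (f x - v₁ x ^ d) * (v₁ x - v x))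
      gain = ≤-trans (*-monoˡ-≤ 0≤c
          (+-mono-≤ violation (neg-mono-≤
            (+-mono-≤ (𝔼-shift-≤ d 0≤v 0≤c mass) (≤-reflexive (-‿cong mass))))))
        (≤-trans
          (≤-reflexive (trans (*-congˡ (sym (trans (𝔼-- _ _) (+-congˡ (-‿cong (𝔼-- _ _))))))
              (sym (𝔼-* c _))))
          (𝔼-mono λ x → ≤-from (0≤c ⊠ diff (^-perturb d 0≤c (c≤v x) (w≤1 x) (-w≤1 x)))
            (solve 7 (λ v c w f V P Q →
               (f :- P) :* ((v :+ c :* w) :- v) :- c :* ((f :- V) :* w :- (Q :- V)) :=
               c :* ((Q :- V) :- (P :- V) :* w))
              refl (v x) c (w x) (f x) (v x ^ d) (v₁ x ^ d) ((v x + c) ^ d))))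
      step₁ : potential N v₁ + fromℕ N * (c * (η - ((1# + c) ^ d - 1#))) ≤ potential N v
      step₁ = ≤-trans (+-mono-≤ ≤-refl (*-monoˡ-≤ (fromℕ-nonNeg N) gain))
        (potential-tangent d 0≤v (λ x → ≤-trans 0≤c (c≤v₁ x)))
      -- The tangent term is N y E[f - (v₁ + y)^d] = 0, since both functions have mass 1.
      step₂ : potential N (λ x → v₁ x + y) ≤ potential N v₁
      step₂ = ≤-respˡ-≈ (trans (+-congˡ (trans (*-congˡ
          (trans (𝔼-cong λ x → solve 4
              (λ f P v y → (f :- P) :* ((v :+ y) :- v) := y :* (f :- P)) refl (f x) _ (v₁ x) y)
            (trans (𝔼-* y _) (trans (*-congˡ
                (trans (𝔼-- f _) (trans (+-cong 𝔼f≈1 (-‿cong mass′)) (-‿inverseʳ 1#))))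
                  (zeroʳ y)))))
          (zeroʳ _))) (+-identityʳ _))
        (potential-tangent d (λ x → ≤-trans 0≤c (c≤v₁ x)) (λ x → 0≤v₁+ x -c≤y))

  -- The iteration: constants, invariant and termination

  module Iteration
    (μ : Function) (μ-prob : IsProbabilityMeasure μ) (f : Function) (f-density : IsDensity μ f)
    (𝓕 : Pred Function 0ℓ) (𝓕-bounded : ∀ {φ} → 𝓕 φ → ∀ x → ∣ φ x ∣ ≤ 1#)
    (η : Carrier) (0<η : 0# < η) (5η≤1 : fromℕ 5 * η ≤ 1#) where
    open Density μ μ-prob f f-density public

    private
      E = Ent μ f
      Q = E ÷ η
      0≤Q = 0≤÷ 0≤Ent 0<η

      η≤1 : η ≤ 1#
      η≤1 = *-cancelˡ-≤ (0<fromℕ 4) (≤-trans 5η≤1 (≤-from (fromℕ-nonNeg 4)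
        (solve 0 (con (+ 5) :* con (+ 1) :- con (+ 1) := con (+ 4)) refl)))

      0<η² : 0# < η ^ 2
      0<η² = 0<⊠ 0<η (0<⊠ 0<η 0<1)

      -- Unification would unfold the search in floor.
      abstract
        T-floor : ∃ λ n → fromℕ n ≤ fromℕ 9 * E ÷ η ^ 2 × fromℕ 9 * E ÷ η ^ 2 < fromℕ (suc n)
        T-floor = floor (0≤÷ (fromℕ-nonNeg 9 ⊠ 0≤Ent) 0<η²)

        M-floor : ∃ λ n → fromℕ n ≤ (fromℕ 12 * Q + fromℕ 2) ÷ fromℕ 4 ×
                          (fromℕ 12 * Q + fromℕ 2) ÷ fromℕ 4 < fromℕ (suc n)
        M-floor = floor (0≤÷ (fromℕ-nonNeg 12 ⊠ 0≤Q ⊞ fromℕ-nonNeg 2) (0<fromℕ 3))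

    T₀ : ℕ
    T₀ = proj₁ T-floor

    T₀≤ : fromℕ T₀ ≤ fromℕ 9 * E ÷ η ^ 2
    T₀≤ = proj₁ (proj₂ T-floor)

    private
      T : ℕ
      T = suc T₀

      T> : fromℕ 9 * E ÷ η ^ 2 < fromℕ T
      T> = proj₂ (proj₂ T-floor)

      M : ℕ
      M = proj₁ M-floor

      4M≤ : fromℕ M * fromℕ 4 ≤ fromℕ 12 * Q + fromℕ 2
      4M≤ = ≤-respʳ-≈ (÷-* (0<fromℕ 3)) (*-monoʳ-≤ (fromℕ-nonNeg 4) (proj₁ (proj₂ M-floor)))

      ≤4M+4 : fromℕ 12 * Q + fromℕ 2 ≤ fromℕ (suc M) * fromℕ 4
      ≤4M+4 = ≤-respˡ-≈ (÷-* (0<fromℕ 3)) (*-monoʳ-≤ (fromℕ-nonNeg 4) (<⇒≤ (proj₂ (proj₂ M-floor))))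

    degree-1 : ℕ
    degree-1 = 2 ℕ.+ 4 ℕ.* M

    -- One less than the least multiple of 4 above 12 Q + 2.
    degree : ℕ
    degree = suc degree-1

    private
      N : ℕ
      N = suc degree

    degree≤ : fromℕ degree ≤ fromℕ 12 * Q + fromℕ 5
    degree≤ = ≤-from (diff 4M≤)
        (trans (+-congˡ (-‿cong (+-congˡ (+-congˡ (+-congˡ (×1-homo-* 4 M))))))
      (solve 2 (λ q m → (con (+ 12) :* q :+ con (+ 5)) :-
          (con (+ 1) :+ (con (+ 1) :+ (con (+ 1) :+ con (+ 4) :* m)))
        := (con (+ 12) :* q :+ con (+ 2)) :- m :* con (+ 4)) refl Q (fromℕ M)))

    private
      12Q+2≤N : fromℕ 12 * Q + fromℕ 2 ≤ fromℕ N
      12Q+2≤N = ≤-trans ≤4M+4 (≤-reflexive (trans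
        (solve 1 (λ m → (con (+ 1) :+ m) :* con (+ 4) :=
          con (+ 1) :+ (con (+ 1) :+ (con (+ 1) :+ (con (+ 1) :+ con (+ 4) :* m)))) refl (fromℕ M))
        (+-congˡ (+-congˡ (+-congˡ (+-congˡ (sym (×1-homo-* 4 M))))))))

      0<2N : 0# < fromℕ 2 * fromℕ N
      0<2N = 0<⊠ (0<fromℕ 1) (0<fromℕ degree)

    abstract
      -- To first order in c a step gains N c (η - N c), which is largest at N c = η/2.
      c : Carrier
      c = η ÷ (fromℕ 2 * fromℕ N)

      0≤c : 0# ≤ c
      0≤c = 0≤÷ (<⇒≤ 0<η) 0<2N

      2Nc≈η : fromℕ 2 * (fromℕ N * c) ≈ η
      2Nc≈η = trans (solve 2 (λ n c → con (+ 2) :* (n :* c) := c :* (con (+ 2) :* n)) refl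
          (fromℕ N) c)
        (÷-* 0<2N)

    private
      T₀η≤9Q : fromℕ T₀ * η ≤ fromℕ 9 * Q
      T₀η≤9Q = *-cancelˡ-≤ 0<η (≤-respˡ-≈
          (solve 2 (λ t η → t :* η :^ 2 := η :* (t :* η)) refl (fromℕ T₀) η)
        (≤-respʳ-≈ (trans (*-congˡ (sym (÷-* 0<η)))
            (solve 2 (λ q η → con (+ 9) :* (q :* η) := η :* (con (+ 9) :* q)) refl Q η))
          (≤-respʳ-≈ (÷-* 0<η²) (*-monoʳ-≤ (<⇒≤ 0<η²) T₀≤))))

      -- The total movement 2cT = Tη/N must not exceed 3/4. With Q = Ent f/η, Tη ≤ 9Q + η ≤ 9Q + 1,
      -- and 4 (9Q + 1) ≤ 3 (12Q + 2) ≤ 3N: this is the origin of 12 = 4 · 9/3, and the summand 2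
      -- pays for the one step by which T exceeds `T₀`.
      budget : fromℕ 4 * (fromℕ T * (fromℕ 2 * c)) ≤ fromℕ 3
      budget = *-cancelˡ-≤ (0<fromℕ degree) (≤-respˡ-≈
        (trans (*-congˡ (sym 2Nc≈η))
            (solve 3 (λ t n c → (con (+ 4) :* (con (+ 1) :+ t)) :* (con (+ 2) :* (n :* c)) :=
            n :* (con (+ 4) :* ((con (+ 1) :+ t) :* (con (+ 2) :* c)))) refl (fromℕ T₀)
                (fromℕ N) c))
        (≤-from (fromℕ-nonNeg 3 ⊠ diff 12Q+2≤N ⊞ fromℕ-nonNeg 4 ⊠ (diff T₀η≤9Q ⊞ diff η≤1)
            ⊞ fromℕ-nonNeg 2)
          (solve 4 (λ t η q n → n :* con (+ 3) :- (con (+ 4) :* (con (+ 1) :+ t)) :* η :=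
            con (+ 3) :* (n :- (con (+ 12) :* q :+ con (+ 2))) :+
            (con (+ 4) :* ((con (+ 9) :* q :- t :* η) :+ (con (+ 1) :- η)) :+ con (+ 2)))
            refl (fromℕ T₀) η Q (fromℕ N))))

      κ : Carrier
      κ = (1# + c) ^ degree

      0≤κ : 0# ≤ κ
      0≤κ = ^-nonNeg degree (0≤1 ⊞ 0≤c)

      dc : Carrier
      dc = fromℕ degree * c

      η≈2c+2dc : η ≈ fromℕ 2 * (c + dc)
      η≈2c+2dc = trans (sym 2Nc≈η)
        (solve 2 (λ d c → con (+ 2) :* ((con (+ 1) :+ d) :* c) := con (+ 2) :* (c :+ d :* c)) refl
            (fromℕ degree) c)

      c≤1 : c ≤ 1#
      c≤1 = ≤-trans (≤-from (0≤c ⊞ fromℕ-nonNeg 2 ⊠ (fromℕ-nonNeg degree ⊠ 0≤c))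
          (trans (+-congʳ η≈2c+2dc)
        (solve 2 (λ c k → con (+ 2) :* (c :+ k) :- c := c :+ con (+ 2) :* k) refl c dc))) η≤1

      -- `bernoulli-reciprocal` with d c = η/2 - c, that is κ ≤ 1/(1 - η/2).
      κ-bound : κ * (fromℕ 2 - η) ≤ fromℕ 2
      κ-bound = ≤-from (fromℕ-nonNeg 2 ⊠ diff (bernoulli-reciprocal degree 0≤c c≤1)
          ⊞ fromℕ-nonNeg 2 ⊠ (0≤κ ⊠ 0≤c))
        (trans (+-congˡ (-‿cong (*-congˡ (+-congˡ (-‿cong η≈2c+2dc)))))
          (solve 3 (λ κ c k → con (+ 2) :- κ :* (con (+ 2) :- con (+ 2) :* (c :+ k)) :=
            con (+ 2) :* (con (+ 1) :- κ :* (con (+ 1) :- k)) :+ con (+ 2) :* (κ :* c)) refl κ c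
                dc))

      9κ≤10 : fromℕ 9 * κ ≤ fromℕ 10
      9κ≤10 = ≤-from (fromℕ-nonNeg 5 ⊠ diff κ-bound ⊞ 0≤κ ⊠ diff 5η≤1)
        (solve 2 (λ κ η → con (+ 10) :- con (+ 9) :* κ :=
          con (+ 5) :* (con (+ 2) :- κ :* (con (+ 2) :- η)) :+ κ :* (con (+ 1) :- con (+ 5) :* η))
              refl κ η)

      -- κ - 1 ≤ κη/2 ≤ 5η/9 leaves 4η/9 of the violation, and N c = η/2. The bound κ ≤ 10/9 is
      -- where η ≤ 1/5 enters.
      gain : fromℕ 2 * η ^ 2 ≤ fromℕ 9 * (fromℕ N * (c * (η - (κ - 1#))))
      gain = *-cancelˡ-≤ (0<fromℕ 3) (≤-from
        (<⇒≤ 0<η ⊠ (fromℕ-nonNeg 9 ⊠ diff κ-bound ⊞ <⇒≤ 0<η ⊠ diff 9κ≤10))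
        (trans (+-congʳ (trans
           (solve 4 (λ n c η κ → let z = η :- (κ :- con (+ 1)) in
             con (+ 4) :* (con (+ 9) :* (n :* (c :* z))) := (con (+ 2) :* (n :* c)) :*
                 (con (+ 18) :* z)) refl (fromℕ N) c η κ)
           (*-congʳ 2Nc≈η)))
         (solve 2 (λ η κ → η :* (con (+ 18) :* (η :- (κ :- con (+ 1)))) :- con (+ 4) :*
             (con (+ 2) :* η :^ 2) :=
            η :* (con (+ 9) :* (con (+ 2) :- κ :* (con (+ 2) :- η)) :+ η :*
                (con (+ 10) :- con (+ 9) :* κ))) refl η κ)))

    -- A step moves v by at most 2c, half along w and half in the shift. The resulting bounds on v
    -- leave room for the next step and, up to T steps, stay in the range where the entropy bounds
    -- the potential from below. The 9 in `energy` clears the denominator of 2η²/9.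
    record State (t : ℕ) : Set where
      field
        φ      : Fin t → Function
        ε      : Fin t → Carrier
        φ∈     : ∀ i → 𝓕 (φ i)
        sign   : ∀ i → IsSign (ε i)
        A      : Carrier
        v      : Function
        v≗     : v ≗ λ x → A + sum {t} (λ i → c * (1# + ε i * φ i x))
        A≥     : 1# - fromℕ t * (fromℕ 2 * c) ≤ A
        v≥     : ∀ x → 1# - fromℕ t * (fromℕ 2 * c) ≤ v x
        v≤     : ∀ x → v x ≤ 1# + fromℕ t * (fromℕ 2 * c)
        mass   : 𝔼 (λ x → v x ^ degree) ≈ 1#
        energy : fromℕ 9 * potential N v + fromℕ t * (fromℕ 2 * η ^ 2) ≤ fromℕ 9

      violates : Pred Function 0ℓ
      violates ψ = η < ∣ ⟨_,_⟩ μ ψ (f ⊖ (λ x → v x ^ degree)) ∣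

    private
      0≤2c : 0# ≤ fromℕ 2 * c
      0≤2c = fromℕ-nonNeg 2 ⊠ 0≤c

      within-budget : ∀ {t} → t ℕ.≤ T → fromℕ 4 * (fromℕ t * (fromℕ 2 * c)) ≤ fromℕ 3
      within-budget t≤T = ≤-trans
          (*-monoˡ-≤ (fromℕ-nonNeg 4) (*-monoʳ-≤ 0≤2c (fromℕ-mono t≤T))) budget

    0≤1-2ct : ∀ {t} → t ℕ.≤ T → 0# ≤ 1# - fromℕ t * (fromℕ 2 * c)
    0≤1-2ct {t} t≤T = *-cancelˡ-≤ (0<fromℕ 3) (≤-from (diff (within-budget t≤T) ⊞ 0≤1)
        (solve 1 (λ s → con (+ 4) :* (con (+ 1) :- s) :- con (+ 4) :* con (+ 0) :=
            (con (+ 3) :- con (+ 4) :* s) :+ con (+ 1))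
          refl (fromℕ t * (fromℕ 2 * c))))

    start : State 0
    start = record
      { φ = λ () ; ε = λ () ; φ∈ = λ () ; sign = λ ()
      ; A = 1# ; v = λ _ → 1#
      ; v≗ = λ _ → sym (+-identityʳ 1#)
      ; A≥ = 1-≤ ; v≥ = λ _ → 1-≤
      ; v≤ = λ _ → ≤-reflexive (solve 1
          (λ c → con (+ 1) := con (+ 1) :+ con (+ 0) :* (con (+ 2) :* c)) refl c)
      ; mass = trans (𝔼-cong λ _ → 1^n≈1 degree) (𝔼-const 1#)
      ; energy = ≤-reflexive (trans (+-congʳ (*-congˡ (potential-1 N)))
          (solve 1 (λ η → con (+ 9) :* con (+ 1) :+ con (+ 0) :* (con (+ 2) :* η :^ 2) := con
              (+ 9)) refl η))
      }
      where
      1-≤ : 1# - 0# * (fromℕ 2 * c) ≤ 1#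
      1-≤ = ≤-reflexive (solve 1
          (λ c → con (+ 1) :- con (+ 0) :* (con (+ 2) :* c) := con (+ 1)) refl c)

    module _ {t} (t<T : t ℕ.< T) (s : State t) where
      open State s

      private
        g : Function
        g x = v x ^ degree

      advance-signed : ∀ {ψ ε₀} → 𝓕 ψ → IsSign ε₀ → (∀ x → ε₀ * ψ x ≤ 1#) →
          (∀ x → - (ε₀ * ψ x) ≤ 1#) →
                       η ≤ ε₀ * ⟨_,_⟩ μ ψ (f ⊖ g) → State (suc t)
      advance-signed {ψ} {ε₀} ψ∈𝓕 sign₀ w≤1 -w≤1 violation = record
        { φ = ψ ∷ φ ; ε = ε₀ ∷ ε
        ; φ∈ = λ { Fin.zero → ψ∈𝓕 ; (Fin.suc i) → φ∈ i }
        ; sign = λ { Fin.zero → sign₀ ; (Fin.suc i) → sign i }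
        -- c w + y = c (1 + w) + (y - c): the new factor receives the coefficient c, and the
        -- constant falls by at most 2c because y ≥ -c.
        ; A = A - c + y
        ; v = v′
        ; v≗ = λ x → trans (+-congʳ (+-congʳ (v≗ x)))
            (solve 5 (λ A S c w y → ((A :+ S) :+ c :* w) :+ y := (A :- c :+ y) :+
                (c :* (con (+ 1) :+ w) :+ S))
              refl A (sum {t} (λ i → c * (1# + ε i * φ i x))) c (ε₀ * ψ x) y)
        ; A≥ = ≤-from (diff A≥ ⊞ diff -c≤y)
            (solve 4 (λ A c y t → (A :- c :+ y) :-
                (con (+ 1) :- (con (+ 1) :+ t) :* (con (+ 2) :* c)) :=
              (A :- (con (+ 1) :- t :* (con (+ 2) :* c))) :+ (y :- :- c)) refl A c y (fromℕ t))
        ; v≥ = λ x → ≤-from (diff (v≥ x) ⊞ diff -c≤y ⊞ 0≤c ⊠ diff (-w≤1 x))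
            (solve 5 (λ v c y t w → (v :+ c :* w :+ y) :-
                (con (+ 1) :- (con (+ 1) :+ t) :* (con (+ 2) :* c)) :=
              (v :- (con (+ 1) :- t :* (con (+ 2) :* c))) :+
                  ((y :- :- c) :+ c :* (con (+ 1) :- :- w)))
              refl (v x) c y (fromℕ t) (ε₀ * ψ x))
        ; v≤ = λ x → ≤-from (diff (v≤ x) ⊞ diff y≤c ⊞ 0≤c ⊠ diff (w≤1 x))
            (solve 5 (λ v c y t w → (con (+ 1) :+ (con (+ 1) :+ t) :* (con (+ 2) :* c)) :-
                (v :+ c :* w :+ y) :=
              ((con (+ 1) :+ t :* (con (+ 2) :* c)) :- v) :+ ((c :- y) :+ c :* (con (+ 1) :- w)))
              refl (v x) c y (fromℕ t) (ε₀ * ψ x))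
        ; mass = mass′
        ; energy = ≤-from (diff energy ⊞ fromℕ-nonNeg 9 ⊠ diff decrease ⊞ diff gain)
            (solve 5 (λ P P′ G t H →
              con (+ 9) :- (con (+ 9) :* P′ :+ (con (+ 1) :+ t) :* H) :=
              (con (+ 9) :- (con (+ 9) :* P :+ t :* H)) :+
                  (con (+ 9) :* (P :- (P′ :+ G)) :+ (con (+ 9) :* G :- H)))
              refl (potential N v) (potential N v′) (fromℕ N * (c * (η - (κ - 1#)))) (fromℕ t)
                  (fromℕ 2 * η ^ 2))
        }
        where
        w : Function
        w x = ε₀ * ψ x
        violation′ : η ≤ 𝔼 (λ x → (f x - g x) * w x)
        violation′ = ≤-trans violation
            (≤-reflexive (trans (*-distribˡ-sum {n} ε₀ _) (sum-cong-≋ {n} λ x →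
          solve 4 (λ e m p h → e :* (m :* p :* h) := m :* (h :* (e :* p))) refl ε₀ (μ x) (ψ x)
              (f x - g x))))
        2c≤v : ∀ x → c + c ≤ v x
        2c≤v x = ≤-trans (≤-from (0≤1-2ct t<T)
          (solve 2 (λ t c → (con (+ 1) :- t :* (con (+ 2) :* c)) :- (c :+ c) := con (+ 1) :-
              (con (+ 1) :+ t) :* (con (+ 2) :* c))
            refl (fromℕ t) c)) (v≥ x)
        v+2c≤2 : ∀ x → v x + (c + c) ≤ fromℕ 2
        v+2c≤2 x = ≤-from (diff (v≤ x) ⊞ 0≤1-2ct t<T)
          (solve 3 (λ v t c → con (+ 2) :- (v :+ (c :+ c)) :=
            ((con (+ 1) :+ t :* (con (+ 2) :* c)) :- v) :+
                (con (+ 1) :- (con (+ 1) :+ t) :* (con (+ 2) :* c)))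
            refl (v x) (fromℕ t) c)
        descent = potential-descent {w = w} degree-1 0≤c 2c≤v v+2c≤2 w≤1 -w≤1 mass violation′
        y = proj₁ descent
        v′ : Function
        v′ x = v x + c * w x + y
        -c≤y = proj₁ (proj₂ descent)
        y≤c = proj₁ (proj₂ (proj₂ descent))
        mass′ = proj₁ (proj₂ (proj₂ (proj₂ descent)))
        decrease = proj₂ (proj₂ (proj₂ (proj₂ descent)))

      advance : ∀ {ψ} → 𝓕 ψ → violates ψ → State (suc t)
      advance {ψ} ψ∈𝓕 violation with ≤∨> η (⟨_,_⟩ μ ψ (f ⊖ g))
      ... | inj₁ η≤z = advance-signed ψ∈𝓕 (inj₂ (inj₂ refl))
            (λ x → ≤-respˡ-≈ (sym (*-identityˡ _)) (≤-trans (x≤∣x∣ _) (𝓕-bounded ψ∈𝓕 x)))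
            (λ x → ≤-respˡ-≈ (-‿cong (sym (*-identityˡ _))) (≤-trans (-x≤∣x∣ _) (𝓕-bounded ψ∈𝓕 x)))
            (≤-respʳ-≈ (sym (*-identityˡ _)) η≤z)
      ... | inj₂ z<η with ≤∨> η (- ⟨_,_⟩ μ ψ (f ⊖ g))
      ...   | inj₁ η≤-z = advance-signed ψ∈𝓕 (inj₁ refl)
            (λ x → ≤-respˡ-≈ (solve 1 (λ p → :- p := (:- con (+ 1)) :* p) refl (ψ x))
              (≤-trans (-x≤∣x∣ _) (𝓕-bounded ψ∈𝓕 x)))
            (λ x → ≤-respˡ-≈ (solve 1 (λ p → p := :- ((:- con (+ 1)) :* p)) refl (ψ x))
              (≤-trans (x≤∣x∣ _) (𝓕-bounded ψ∈𝓕 x)))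
            (≤-respʳ-≈ (solve 1 (λ p → :- p := (:- con (+ 1)) :* p) refl _) η≤-z)
      ...   | inj₂ -z<η = contradiction (∣x∣≤ (<⇒≤ z<η) (<⇒≤ -z<η)) (<⇒≱ violation)

    -- After T steps `energy` would give 2Tη² ≤ 9 (1 - potential) ≤ 18 Ent f, contrary to the choice
    -- of T.
    exhausted : ¬ State T
    exhausted s = <⇒≱ T> (≤-÷ 0<η² (*-cancelˡ-≤ (0<fromℕ 1) (≤-from
        (diff energy ⊞ fromℕ-nonNeg 9 ⊠ diff lower-bound)
        (solve 4 (λ P e t h → con (+ 2) :* (con (+ 9) :* e) :- con (+ 2) :* (t :* h) :=
          (con (+ 9) :- (con (+ 9) :* P :+ t :* (con (+ 2) :* h))) :+ con (+ 9) :*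
              ((P :+ con (+ 2) :* e) :- con (+ 1)))
          refl (potential N v) E (fromℕ T) (η ^ 2)))))
      where
      open State s
      lower-bound : 1# ≤ potential N v + fromℕ 2 * E
      -- N unfolds to 4 + 4M, while the entropy bound is stated for 4 (M + 1).
      lower-bound = ≡.subst (λ N → 1# ≤ potential N v + fromℕ 2 * E) (ℕ.*-suc 4 M)
        (1≤potential+2Ent (suc M)
          (λ x → ≤-from (diff budget ⊞ fromℕ-nonNeg 4 ⊠ diff (v≤ x))
            (solve 2 (λ v s → (con (+ 3) :- con (+ 4) :* (v :- con (+ 1))) :- con (+ 0) :=
              (con (+ 3) :- con (+ 4) :* s) :+ con (+ 4) :* ((con (+ 1) :+ s) :- v)) refl (v x)
                  (fromℕ T * (fromℕ 2 * c))))
          (λ x → ≤-from (diff budget ⊞ fromℕ-nonNeg 4 ⊠ diff (v≥ x))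
            (solve 2 (λ v s → (con (+ 3) :+ con (+ 4) :* (v :- con (+ 1))) :- con (+ 0) :=
              (con (+ 3) :- con (+ 4) :* s) :+ con (+ 4) :* (v :- (con (+ 1) :- s))) refl (v x)
                  (fromℕ T * (fromℕ 2 * c)))))

    Terminal : ∀ {t} → State t → Set
    Terminal s = ∀ {ψ} → 𝓕 ψ → ∣ ⟨_,_⟩ μ ψ (f ⊖ (λ x → State.v s x ^ degree)) ∣ ≤ η

    run : ∀ t → t ℕ.≤ T → (∃ λ j → j ℕ.< T × ∃ λ (s : State j) → Terminal s) ⊎ State t
    run zero    _     = inj₂ start
    run (suc t) t<T with run t (ℕ.<⇒≤ t<T)
    ... | inj₁ done = inj₁ done
    ... | inj₂ s with em {∃ λ ψ → 𝓕 ψ × State.violates s ψ}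
    ...   | yes (ψ , ψ∈𝓕 , violation) = inj₂ (advance t<T s ψ∈𝓕 violation)
    ...   | no ¬violated = inj₁ (t , t<T , s , terminal)
      where
      terminal : Terminal s
      terminal {ψ} ψ∈𝓕 with ≤∨> ∣ ⟨_,_⟩ μ ψ (f ⊖ (λ x → State.v s x ^ degree)) ∣ η
      ... | inj₁ ≤η = ≤η
      ... | inj₂ η< = contradiction (ψ , ψ∈𝓕 , η<) ¬violated

    terminal-state : ∃ λ j → j ℕ.< T × ∃ λ (s : State j) → Terminal s
    terminal-state with run T ℕ.≤-refl
    ... | inj₁ done = done
    ... | inj₂ s    = contradiction s exhausted

  -- The approximant and its properties

  module _ (μ : Function) (μ-prob : IsProbabilityMeasure μ)
           (𝓕 : Pred Function 0ℓ) (‖𝓕‖≤1 : sup‖ 𝓕 ‖∞≤ 1#)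
           (η : Carrier) (0<η : 0# < η) (η<e⁻³ : η < exp (- fromℕ 3))
           (f : Function) (f-density : IsDensity μ f) where
    open Iteration μ μ-prob f f-density 𝓕 (∣φ∣≤ 𝓕 ‖𝓕‖≤1) η 0<η (5η≤1 0<η η<e⁻³)

    private
      j = proj₁ terminal-state
      j<T = proj₁ (proj₂ terminal-state)
      s = proj₁ (proj₂ (proj₂ terminal-state))
      terminal = proj₂ (proj₂ (proj₂ terminal-state))
      open State s

      g : Function
      g x = v x ^ degree

      0≤g : ∀ x → 0# ≤ g x
      0≤g x = ^-nonNeg degree (≤-trans (0≤1-2ct (ℕ.<⇒≤ j<T)) (v≥ x))

      0≤A : 0# ≤ A
      0≤A = ≤-trans (0≤1-2ct (ℕ.<⇒≤ j<T)) A≥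

      -- Propositional equality, because 𝓕 is an arbitrary predicate and need not respect `≗`; the
      -- inclusion in 𝓕 then follows by matching on `≡.refl`.
      𝓕′ : Pred Function 0ℓ
      𝓕′ ψ = ∃ λ i → ψ ≡ φ i

    approximation : ∃ λ (g : Function) →
      IsDensity μ g ×
      Seminorm≤ μ 𝓕 (f ⊖ g) η ×
      ∃ λ (𝓕′ : Pred Function 0ℓ) →
        𝓕′ ⊆ 𝓕 ×
        (∃ λ (k : ℕ) → HasAtMost k 𝓕′ × fromℕ k ≤ fromℕ 9 * Ent μ f ÷ η ^ 2) ×
        (∃ λ (d : ℕ) →
          fromℕ d ≤ fromℕ 12 * (Ent μ f ÷ η) + fromℕ 5 * (log (1# ÷ η) ÷ log (log (1# ÷ η))) ×
          IsNonNegCombination (IsRieszProduct 𝓕′ d) g)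
    approximation =
      g ,
      (0≤g , trans (𝔼-cong λ x → ∣x∣≈x (0≤g x)) mass) ,
      bounded-sup (λ r (φ , _ , r≈) → ≤-respʳ-≈ (sym r≈) (0≤∣x∣ _)) (<⇒≤ 0<η)
        (λ r (φ , φ∈𝓕 , r≈) → ≤-respˡ-≈ (sym r≈) (terminal φ∈𝓕)) ,
      𝓕′ ,
      (λ { (i , ≡.refl) → φ∈ i }) ,
      -- j < T means j ≤ `T₀`. A function chosen at several steps is merely listed repeatedly.
      (j , (φ , λ { ψ (i , ≡.refl) → i , λ _ → refl }) , ≤-trans (fromℕ-mono (ℕ.≤-pred j<T)) T₀≤) ,
      degree ,
      -- The additive constant 5 is absorbed because the ratio of logarithms is at least 1.
      ≤-trans degree≤ (+-mono-≤ ≤-refl (≤-respˡ-≈ (*-identityʳ _)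
        (*-monoˡ-≤ (fromℕ-nonNeg 5) (1≤log/loglog 0<η η<e⁻³)))) ,
      Combination.get {𝓡 = IsRieszProduct 𝓕′ degree}
        (combination-cong (λ x → ^-congˡ degree (sym (v≗ x)))
          (affine-riesz 𝓕′ φ ε sign (λ i → i , ≡.refl) 0≤A 0≤c degree-1))

theorem2p1 :
    (em : ExcludedMiddle 0ℓ) (ℝ : CompleteOrderedField) →
    let open CompleteOrderedField ℝ
        open ExpLog em ℝ
        open Densities em ℝ
    in
    ∃ λ (C : Carrier) →
    (n : ℕ) (μ : Function {n}) → IsProbabilityMeasure μ →
    (𝓕 : Pred (Function {n}) 0ℓ) → sup‖ 𝓕 ‖∞≤ 1# →
    (η : Carrier) → 0# < η → η < exp (- fromℕ 3) →
    (f : Function {n}) → IsDensity μ f →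
    ∃ λ (g : Function {n}) →
      IsDensity μ g ×
      Seminorm≤ μ 𝓕 (f ⊖ g) η ×
      ∃ λ (𝓕′ : Pred (Function {n}) 0ℓ) →
        𝓕′ ⊆ 𝓕 ×
        (∃ λ (k : ℕ) → HasAtMost k 𝓕′ × fromℕ k ≤ fromℕ 9 * Ent μ f ÷ η ^ 2) ×
        (∃ λ (d : ℕ) →
          fromℕ d ≤ fromℕ 12 * (Ent μ f ÷ η) + C * (log (1# ÷ η) ÷ log (log (1# ÷ η))) ×
          IsNonNegCombination (IsRieszProduct 𝓕′ d) g)
theorem2p1 em ℝ = CompleteOrderedField.fromℕ ℝ 5 ,
  λ n μ μ-prob 𝓕 ‖𝓕‖≤1 η 0<η η<e⁻³ f f-density →
    OnFiniteSet.approximation em ℝ μ μ-prob 𝓕 ‖𝓕‖≤1 η 0<η η<e⁻³ f f-density
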